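{- Let $A \geq 2$ and $B, C \geq 0$ be integers, and for integers $n \geq 0$ define \[ \mathcal{S}(n; A, B, C) = \sum_{k=0}^{n} \binom{n}{k}^A \binom{n+k}{k}^B \binom{2k}{n}^C . \] Then for all integers $m \geq 1$, $r \geq 1$ and all primes $p \geq 5$, \[ \mathcal{S}(m p^r; A, B, C) \equiv \mathcal{S}(m p^{r-1}; A, B, C) \pmod{p^{3r}}. \]
   Context: Binomial coefficients $\binom{a}{b}$ with $0\le a<b$ are $0$. -}

module Defs where

open import Data.Nat using (ℕ; zero; suc; _+_; _*_; _^_)
open import Data.Nat.Combinatorics using (_C_)
open import Data.List using (map; upTo)
open import Data.Nat.ListAction using (sum)
open import Data.Integer using (ℤ; +_; _-_)
open import Data.Integer.Divisibility using (_∣_)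

-- 𝒮 n a b c = 𝒮(n; A, B, C) with (A,B,C)=(a,b,c): = Σ_{k=0}^{n} (n C k)^A (n+k C k)^B (2k C n)^C
-- (upTo (suc n) = [0, 1, …, n]; stdlib's _C_ is 0 when k > n)
𝒮 : ℕ → ℕ → ℕ → ℕ → ℕ
𝒮 n a b c = sum (map (λ k → ((n C k) ^ a) * (((n + k) C k) ^ b) * (((2 * k) C n) ^ c)) (upTo (suc n)))

_≡_[mod_] : ℕ → ℕ → ℕ → Set
a ≡ b [mod M ] = (+ M) ∣ ((+ a) - (+ b))

{-# OPTIONS --safe #-}
module Submission where

-- Put N = m pʳ and n = N / p. The terms with p ∣ k are matched with the terms of the sum for n through
-- Jacobsthal's congruence for (pa choose pb) / (a choose b); with s = min (v(k / p), r − 1) the ratios are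
-- 1 modulo p^(2 + r + 2s), and (n choose k / p)² supplies the missing factor p^(2 (r − 1 − s)).
-- The terms with p ∤ k equal N² k⁻² times products of binomial coefficients (and vanish for A > 2).
-- Modulo pʳ such a product depends on 2k only through ⌊2k / p⌋, modulo pʳ⁻¹ the new one only through
-- ⌊2k / p²⌋, and so on; the sum of k⁻² over the k with p ∤ k and given ⌊2k / pˢ⌋ is 0 modulo pˢ,
-- so collecting the terms in s = 1, …, r steps shows that their sum is 0 modulo pʳ.

open import Defs
open import Data.Nat as ℕ using (ℕ; zero; suc; _∸_; _≤_; _<_; z≤n; s≤s; ⌊_/2⌋)
open import Data.Nat.Combinatorics using (_C_; nCk≡nC[n∸k]; k>n⇒nCk≡0; nCk+nC[k+1]≡[n+1]C[k+1])
open import Data.Nat.Coprimality using (Coprime; coprime-Bézout)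
import Data.Nat.Divisibility as ℕ
open import Data.Nat.GCD using (module Bézout)
open import Data.Nat.ListAction using (sum)
open import Data.Nat.Primality using (Prime; prime⇒irreducible; prime⇒nonZero; prime[2]; euclidsLemma)
import Data.Nat.Properties as ℕ
import Data.Nat.Tactic.RingSolver as ℕ-Solver
open import Data.Integer using (ℤ; +_; -_; _+_; _-_; _*_; _^_; 0ℤ; 1ℤ; -1ℤ; NonZero)
open import Data.Integer.Divisibility.Signed
  using (_∣_; divides; ∣-refl; ∣-trans; ∣m∣n⇒∣m+n; ∣m⇒∣-m; ∣m⇒∣m*n; ∣n⇒∣m*n; ∣⇒∣ᵤ; *-cancelʳ-∣)
import Data.Integer.Properties as ℤ
open import Data.Integer.Tactic.RingSolver using (solve-∀)
open import Data.List using (applyUpTo)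
open import Data.List.Properties using (map-upTo)
open import Data.Product using (_×_; _,_; ∃-syntax; proj₁; proj₂)
open import Data.Sum using (_⊎_; inj₁; inj₂; [_,_]′)
open import Function using (_∘_; it)
open import Relation.Binary.Bundles using (Setoid)
open import Relation.Binary.PropositionalEquality
  using (_≡_; refl; sym; trans; cong; cong₂; subst; subst₂; module ≡-Reasoning)
open import Relation.Nullary using (¬_; yes; no; contradiction)

-- Congruences and finite sums in ℤ

-- The terms with p ∤ k get only p^(2r) from N²; the missing pʳ must come from cancellation among
-- them. The shape of this part is dictated by (2k choose N): it depends on ⌊2k / p⌋, which is not a
-- function of ⌊k / p⌋. So the summation variable is h = 2k, running through the even numbers below
-- 2N, and what must cancel are the inverse squares of the even members of a block of pˢ consecutive
-- integers. Reflecting the block does not suffice for this; together with doubling it yields 6 E ≡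
-- 0 for the half sum E, so p = 2 and p = 3 have to be excluded. All binomial coefficients are
-- handled as one function, (x + 1)⋯(x + k) / k!: x = n gives (n + k choose k), x = -n gives (n - 1
-- choose k) up to sign, and (2k choose n) is (n + l choose l) with l = 2k - n. Splitting off the
-- factors prime to p leaves the same function for x / p. The exponent 2 + r + 2s of the ratios is 3
-- plus the exponents r - 1, s and s guaranteed for n, for the lower index and for their sum or
-- difference.

infix 4 _≅_[_]

-- A record, so that Agda can infer a and b from a congruence.
record _≅_[_] (a b M : ℤ) : Set where
  constructor ∣-diff
  field diff : M ∣ a - b

open _≅_[_] public

private variable
  a b c d x y L M : ℤ
  f g : ℕ → ℤ

≡⇒≅ : a ≡ b → a ≅ b [ M ]
≡⇒≅ {a} refl = ∣-diff (divides 0ℤ (ℤ.+-inverseʳ a))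

≅-refl : a ≅ a [ M ]
≅-refl = ≡⇒≅ refl

≅-sym : a ≅ b [ M ] → b ≅ a [ M ]
≅-sym {a} {b} (∣-diff p) = ∣-diff (subst (_ ∣_) (swap a b) (∣m⇒∣-m p))
  where
  swap : ∀ a b → - (a - b) ≡ b - a
  swap = solve-∀

≅-trans : a ≅ b [ M ] → b ≅ c [ M ] → a ≅ c [ M ]
≅-trans {a} {b} {c = c} (∣-diff p) (∣-diff q) =
  ∣-diff (subst (_ ∣_) (telescope a b c) (∣m∣n⇒∣m+n p q))
  where
  telescope : ∀ a b c → (a - b) + (b - c) ≡ a - c
  telescope = solve-∀

≅-setoid : ℤ → Setoid _ _
≅-setoid M = record
  { Carrier = ℤ
  ; _≈_ = λ a b → a ≅ b [ M ]
  ; isEquivalence = record { refl = ≅-refl ; sym = ≅-sym ; trans = ≅-trans }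
  }

module ≅-Reasoning (M : ℤ) where
  open import Relation.Binary.Reasoning.Setoid (≅-setoid M) public

≅-weaken : L ∣ M → a ≅ b [ M ] → a ≅ b [ L ]
≅-weaken L∣M (∣-diff p) = ∣-diff (∣-trans L∣M p)

+-cong : a ≅ b [ M ] → c ≅ d [ M ] → a + c ≅ b + d [ M ]
+-cong {a} {b} {c = c} {d} (∣-diff p) (∣-diff q) =
  ∣-diff (subst (_ ∣_) (regroup a b c d) (∣m∣n⇒∣m+n p q))
  where
  regroup : ∀ a b c d → (a - b) + (c - d) ≡ (a + c) - (b + d)
  regroup = solve-∀

*-cong : a ≅ b [ M ] → c ≅ d [ M ] → a * c ≅ b * d [ M ]
*-cong {a} {b} {c = c} {d} (∣-diff p) (∣-diff q) =
  ∣-diff (subst (_ ∣_) (regroup a b c d) (∣m∣n⇒∣m+n (∣m⇒∣m*n c p) (∣n⇒∣m*n b q)))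
  where
  regroup : ∀ a b c d → (a - b) * c + b * (c - d) ≡ a * c - b * d
  regroup = solve-∀

*-congˡ : ∀ c → a ≅ b [ M ] → c * a ≅ c * b [ M ]
*-congˡ c = *-cong (≅-refl {c})

*-congʳ : ∀ c → a ≅ b [ M ] → a * c ≅ b * c [ M ]
*-congʳ c a≅b = *-cong a≅b (≅-refl {c})

^-cong : ∀ n → a ≅ b [ M ] → a ^ n ≅ b ^ n [ M ]
^-cong zero    a≅b = ≅-refl
^-cong (suc n) a≅b = *-cong a≅b (^-cong n a≅b)

*-∣ : M ∣ a → L ∣ b → M * L ∣ a * b
*-∣ {M} {L = L} (divides q refl) (divides r refl) = divides (q * r) (regroup q M r L)
  where
  regroup : ∀ q M r L → (q * M) * (r * L) ≡ (q * r) * (M * L)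
  regroup = solve-∀

-- The recurring way to gain precision: powers of p in a common factor are added to the modulus.
*-scale : L ∣ c → a ≅ b [ M ] → c * a ≅ c * b [ L * M ]
*-scale {c = c} {a} {b} L∣c (∣-diff p) = ∣-diff (subst (_ ∣_) (distrib c a b) (*-∣ L∣c p))
  where
  distrib : ∀ c a b → c * (a - b) ≡ c * a - c * b
  distrib = solve-∀

∣⇒≅0 : M ∣ a → a ≅ 0ℤ [ M ]
∣⇒≅0 {a = a} p = ∣-diff (subst (_ ∣_) (sym (ℤ.+-identityʳ a)) p)

≅0⇒∣ : a ≅ 0ℤ [ M ] → M ∣ a
≅0⇒∣ {a} (∣-diff p) = subst (_ ∣_) (ℤ.+-identityʳ a) p

∣-resp-≅ : a ≅ b [ M ] → M ∣ b → M ∣ a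
∣-resp-≅ a≅b p = ≅0⇒∣ (≅-trans a≅b (∣⇒≅0 p))

^-monoʳ-∣ : ∀ x {m n} → m ≤ n → x ^ m ∣ x ^ n
^-monoʳ-∣ x {m} {n} m≤n = divides (x ^ (n ∸ m)) (begin
  x ^ n                 ≡⟨ cong (x ^_) (ℕ.m∸n+n≡m m≤n) ⟨
  x ^ (n ∸ m ℕ.+ m)     ≡⟨ ℤ.^-distribˡ-+-* x (n ∸ m) m ⟩
  x ^ (n ∸ m) * x ^ m   ∎)
  where open ≡-Reasoning

∑ ∏ : ℕ → (ℕ → ℤ) → ℤ
∑ zero    f = 0ℤ
∑ (suc n) f = ∑ n f + f n
∏ zero    f = 1ℤ
∏ (suc n) f = ∏ n f * f n

∑-cong : ∀ n → (∀ i → i < n → f i ≅ g i [ M ]) → ∑ n f ≅ ∑ n g [ M ]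
∑-cong zero    eq = ≅-refl
∑-cong (suc n) eq = +-cong (∑-cong n λ i i<n → eq i (ℕ.m<n⇒m<1+n i<n)) (eq n ℕ.≤-refl)

∏-cong : ∀ n → (∀ i → i < n → f i ≅ g i [ M ]) → ∏ n f ≅ ∏ n g [ M ]
∏-cong zero    eq = ≅-refl
∏-cong (suc n) eq = *-cong (∏-cong n λ i i<n → eq i (ℕ.m<n⇒m<1+n i<n)) (eq n ℕ.≤-refl)

∑-cong-≡ : ∀ n → (∀ i → f i ≡ g i) → ∑ n f ≡ ∑ n g
∑-cong-≡ zero    eq = refl
∑-cong-≡ (suc n) eq = cong₂ _+_ (∑-cong-≡ n eq) (eq n)

∑-∣ : ∀ n → (∀ i → M ∣ f i) → M ∣ ∑ n f
∑-∣ zero    p = divides 0ℤ refl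
∑-∣ (suc n) p = ∣m∣n⇒∣m+n (∑-∣ n p) (p n)

∑-zero : ∀ n → (∀ i → i < n → f i ≡ 0ℤ) → ∑ n f ≡ 0ℤ
∑-zero zero    eq = refl
∑-zero (suc n) eq = cong₂ _+_ (∑-zero n λ i i<n → eq i (ℕ.m<n⇒m<1+n i<n)) (eq n ℕ.≤-refl)

∑-+ : ∀ n → ∑ n (λ i → f i + g i) ≡ ∑ n f + ∑ n g
∑-+ zero = refl
∑-+ {f} {g} (suc n) = trans (cong (_+ (f n + g n)) (∑-+ n)) (regroup (∑ n f) (∑ n g) (f n) (g n))
  where
  regroup : ∀ a b c d → (a + b) + (c + d) ≡ (a + c) + (b + d)
  regroup = solve-∀

*-distribˡ-∑ : ∀ c n → c * ∑ n f ≡ ∑ n (λ i → c * f i)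
*-distribˡ-∑ c zero    = ℤ.*-zeroʳ c
*-distribˡ-∑ {f} c (suc n) =
  trans (ℤ.*-distribˡ-+ c (∑ n f) (f n)) (cong (_+ c * f n) (*-distribˡ-∑ c n))

*-distribʳ-∑ : ∀ c n → ∑ n f * c ≡ ∑ n (λ i → f i * c)
*-distribʳ-∑ c zero    = ℤ.*-zeroˡ c
*-distribʳ-∑ {f} c (suc n) =
  trans (ℤ.*-distribʳ-+ c (∑ n f) (f n)) (cong (_+ f n * c) (*-distribʳ-∑ c n))

∑-first : ∀ n → ∑ (suc n) f ≡ f 0 + ∑ n (λ i → f (suc i))
∑-first {f} zero = ℤ.+-comm 0ℤ (f 0)
∑-first {f} (suc n) =
  trans (cong (_+ f (suc n)) (∑-first n)) (ℤ.+-assoc (f 0) _ (f (suc n)))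

∏-first : ∀ n → ∏ (suc n) f ≡ f 0 * ∏ n (λ i → f (suc i))
∏-first {f} zero = ℤ.*-comm 1ℤ (f 0)
∏-first {f} (suc n) =
  trans (cong (_* f (suc n)) (∏-first n)) (ℤ.*-assoc (f 0) _ (f (suc n)))

∑-reverse : ∀ n → ∑ n f ≡ ∑ n (λ i → f (n ∸ suc i))
∑-reverse zero = refl
∑-reverse {f} (suc n) = begin
  ∑ n f + f n                        ≡⟨ cong (_+ f n) (∑-reverse n) ⟩
  ∑ n (λ i → f (n ∸ suc i)) + f n    ≡⟨ ℤ.+-comm _ (f n) ⟩
  f n + ∑ n (λ i → f (n ∸ suc i))    ≡⟨ ∑-first n ⟨
  ∑ (suc n) (λ i → f (n ∸ i))        ∎
  where open ≡-Reasoning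

∏-reverse : ∀ n → ∏ n f ≡ ∏ n (λ i → f (n ∸ suc i))
∏-reverse zero = refl
∏-reverse {f} (suc n) = begin
  ∏ n f * f n                        ≡⟨ cong (_* f n) (∏-reverse n) ⟩
  ∏ n (λ i → f (n ∸ suc i)) * f n    ≡⟨ ℤ.*-comm _ (f n) ⟩
  f n * ∏ n (λ i → f (n ∸ suc i))    ≡⟨ ∏-first n ⟨
  ∏ (suc n) (λ i → f (n ∸ i))        ∎
  where open ≡-Reasoning

∏-* : ∀ n → ∏ n (λ i → f i * g i) ≡ ∏ n f * ∏ n g
∏-* zero = refl
∏-* {f} {g} (suc n) = trans (cong (_* (f n * g n)) (∏-* n)) (regroup (∏ n f) (∏ n g) (f n) (g n))
  where
  regroup : ∀ a b c d → (a * b) * (c * d) ≡ (a * c) * (b * d)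
  regroup = solve-∀

∑-split : ∀ m n → ∑ (m ℕ.+ n) f ≡ ∑ m f + ∑ n (λ i → f (m ℕ.+ i))
∑-split {f} m zero = trans (cong (λ k → ∑ k f) (ℕ.+-identityʳ m)) (sym (ℤ.+-identityʳ _))
∑-split {f} m (suc n) = begin
  ∑ (m ℕ.+ suc n) f                                    ≡⟨ cong (λ k → ∑ k f) (ℕ.+-suc m n) ⟩
  ∑ (m ℕ.+ n) f + f (m ℕ.+ n)                          ≡⟨ cong (_+ f (m ℕ.+ n)) (∑-split m n) ⟩
  (∑ m f + ∑ n (λ i → f (m ℕ.+ i))) + f (m ℕ.+ n)      ≡⟨ ℤ.+-assoc (∑ m f) _ _ ⟩
  ∑ m f + ∑ (suc n) (λ i → f (m ℕ.+ i))                ∎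
  where open ≡-Reasoning

∑-blocks : ∀ m n → ∑ (m ℕ.* n) f ≡ ∑ m (λ j → ∑ n (λ i → f (j ℕ.* n ℕ.+ i)))
∑-blocks zero n = refl
∑-blocks {f} (suc m) n = begin
  ∑ (n ℕ.+ m ℕ.* n) f                                       ≡⟨ cong (λ k → ∑ k f) (ℕ.+-comm n (m ℕ.* n)) ⟩
  ∑ (m ℕ.* n ℕ.+ n) f                                       ≡⟨ ∑-split (m ℕ.* n) n ⟩
  ∑ (m ℕ.* n) f + ∑ n (λ i → f (m ℕ.* n ℕ.+ i))             ≡⟨ cong (_+ ∑ n (λ i → f (m ℕ.* n ℕ.+ i))) (∑-blocks m n) ⟩
  ∑ (suc m) (λ j → ∑ n (λ i → f (j ℕ.* n ℕ.+ i)))           ∎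
  where open ≡-Reasoning

∑-even-odd : ∀ n → ∑ (n ℕ.* 2) f ≡ ∑ n (λ i → f (i ℕ.* 2)) + ∑ n (λ i → f (suc (i ℕ.* 2)))
∑-even-odd zero = refl
∑-even-odd {f} (suc n) =
  trans (cong (λ s → (s + f (n ℕ.* 2)) + f (suc (n ℕ.* 2))) (∑-even-odd n))
    (regroup (∑ n λ i → f (i ℕ.* 2)) (∑ n λ i → f (suc (i ℕ.* 2))) (f (n ℕ.* 2)) (f (suc (n ℕ.* 2))))
  where
  regroup : ∀ a b c d → ((a + b) + c) + d ≡ (a + c) + (b + d)
  regroup = solve-∀

-- Every term of degree at least two in `x` contains x², so only the linear part of the product
-- survives.
∏-1+≅ : ∀ n → M ∣ x * x → ∏ n (λ i → 1ℤ + x * f i) ≅ 1ℤ + x * ∑ n f [ M ]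
∏-1+≅ {M} {x} {f} zero p = ≡⇒≅ (expand x)
  where
  expand : ∀ x → 1ℤ ≡ 1ℤ + x * 0ℤ
  expand = solve-∀
∏-1+≅ {M} {x} {f} (suc n) p = begin
  ∏ n (λ i → 1ℤ + x * f i) * (1ℤ + x * f n)      ≈⟨ *-congʳ (1ℤ + x * f n) (∏-1+≅ {x = x} {f = f} n p) ⟩
  (1ℤ + x * ∑ n f) * (1ℤ + x * f n)              ≡⟨ expand x (∑ n f) (f n) ⟩
  (1ℤ + x * (∑ n f + f n)) + x * x * (∑ n f * f n)
    ≈⟨ +-cong (≅-refl {1ℤ + x * (∑ n f + f n)}) (∣⇒≅0 (∣m⇒∣m*n (∑ n f * f n) p)) ⟩
  (1ℤ + x * (∑ n f + f n)) + 0ℤ                  ≡⟨ ℤ.+-identityʳ _ ⟩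
  1ℤ + x * (∑ n f + f n)                         ∎
  where
  open ≅-Reasoning M
  expand : ∀ x s t → (1ℤ + x * s) * (1ℤ + x * t) ≡ (1ℤ + x * (s + t)) + x * x * (s * t)
  expand = solve-∀

-- Parity, and sums over the even or the odd indices

parity : ∀ n → (∃[ m ] n ≡ m ℕ.* 2) ⊎ (∃[ m ] n ≡ suc (m ℕ.* 2))
parity zero = inj₁ (0 , refl)
parity (suc n) with parity n
... | inj₁ (m , refl) = inj₂ (m , refl)
... | inj₂ (m , refl) = inj₁ (suc m , refl)

-- An indicator function in ℤ rather than a predicate, so that a sum over even indices is a weighted
-- sum over all indices and can be cut into blocks of odd length.
even : ℕ → ℤ
even zero    = 1ℤ
even (suc n) = 1ℤ - even n

even-*2+ : ∀ m n → even (m ℕ.* 2 ℕ.+ n) ≡ even n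
even-*2+ zero    n = refl
even-*2+ (suc m) n = trans (involutive (even (m ℕ.* 2 ℕ.+ n))) (even-*2+ m n)
  where
  involutive : ∀ x → 1ℤ - (1ℤ - x) ≡ x
  involutive = solve-∀

even-*2 : ∀ m → even (m ℕ.* 2) ≡ 1ℤ
even-*2 m = trans (cong even (sym (ℕ.+-identityʳ (m ℕ.* 2)))) (even-*2+ m 0)

even-1+*2 : ∀ m → even (suc (m ℕ.* 2)) ≡ 0ℤ
even-1+*2 m = cong (λ x → 1ℤ - x) (even-*2 m)

∑-even : ∀ n → ∑ (n ℕ.* 2) (λ i → even i * f i) ≡ ∑ n (λ i → f (i ℕ.* 2))
∑-even {f} n = begin
  ∑ (n ℕ.* 2) (λ i → even i * f i)
    ≡⟨ ∑-even-odd n ⟩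
  ∑ n (λ i → even (i ℕ.* 2) * f (i ℕ.* 2)) + ∑ n (λ i → even (suc (i ℕ.* 2)) * f (suc (i ℕ.* 2)))
    ≡⟨ cong₂ _+_
         (∑-cong-≡ n λ i → trans (cong (_* f (i ℕ.* 2)) (even-*2 i)) (ℤ.*-identityˡ (f (i ℕ.* 2))))
         (∑-zero n λ i _ → cong (_* f (suc (i ℕ.* 2))) (even-1+*2 i)) ⟩
  ∑ n (λ i → f (i ℕ.* 2)) + 0ℤ
    ≡⟨ ℤ.+-identityʳ _ ⟩
  ∑ n (λ i → f (i ℕ.* 2)) ∎
  where open ≡-Reasoning

∑-odd : ∀ n → ∑ (n ℕ.* 2) (λ i → even (suc i) * f i) ≡ ∑ n (λ i → f (suc (i ℕ.* 2)))
∑-odd {f} n = begin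
  ∑ (n ℕ.* 2) (λ i → even (suc i) * f i)
    ≡⟨ ∑-even-odd n ⟩
  ∑ n (λ i → even (suc (i ℕ.* 2)) * f (i ℕ.* 2)) + ∑ n (λ i → even (suc i ℕ.* 2) * f (suc (i ℕ.* 2)))
    ≡⟨ cong₂ _+_
         (∑-zero n λ i _ → cong (_* f (i ℕ.* 2)) (even-1+*2 i))
         (∑-cong-≡ n λ i → trans (cong (_* f (suc (i ℕ.* 2))) (even-*2 (suc i))) (ℤ.*-identityˡ (f (suc (i ℕ.* 2))))) ⟩
  0ℤ + ∑ n (λ i → f (suc (i ℕ.* 2)))
    ≡⟨ ℤ.+-identityˡ _ ⟩
  ∑ n (λ i → f (suc (i ℕ.* 2))) ∎
  where open ≡-Reasoning

pos-^ : ∀ m n → + (m ℕ.^ n) ≡ (+ m) ^ n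
pos-^ m zero    = refl
pos-^ m (suc n) = trans (ℤ.pos-* m (m ℕ.^ n)) (cong (+ m *_) (pos-^ m n))

pos-∸ : ∀ {m n} → n ≤ m → + (m ∸ n) ≡ + m - + n
pos-∸ {m} {n} n≤m = trans (sym (ℤ.⊖-≥ n≤m)) (sym (ℤ.m-n≡m⊖n m n))

1∣ : ∀ x → 1ℤ ∣ x
1∣ x = divides x (sym (ℤ.*-identityʳ x))

pos-∣ : ∀ {m n} → m ℕ.∣ n → + m ∣ + n
pos-∣ {m} (ℕ.divides q refl) = divides (+ q) (ℤ.pos-* q m)

-- Binomial coefficients

[1+k]*[1+n]C[1+k]≡[1+n]*nCk : ∀ n k → suc k ℕ.* (suc n C suc k) ≡ suc n ℕ.* (n C k)
[1+k]*[1+n]C[1+k]≡[1+n]*nCk zero zero = refl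
[1+k]*[1+n]C[1+k]≡[1+n]*nCk zero (suc k) = ℕ.*-zeroʳ (suc (suc k))
[1+k]*[1+n]C[1+k]≡[1+n]*nCk (suc n) zero = begin
  1 ℕ.* (suc (suc n) C 1)             ≡⟨ ℕ.*-identityˡ _ ⟩
  suc (suc n) C 1                     ≡⟨ nCk+nC[k+1]≡[n+1]C[k+1] (suc n) 0 ⟨
  1 ℕ.+ (suc n C 1)                   ≡⟨ cong suc (ℕ.*-identityˡ (suc n C 1)) ⟨
  1 ℕ.+ 1 ℕ.* (suc n C 1)             ≡⟨ cong suc ([1+k]*[1+n]C[1+k]≡[1+n]*nCk n zero) ⟩
  1 ℕ.+ suc n ℕ.* 1                   ≡⟨⟩
  suc (suc n) ℕ.* 1                   ∎
  where open ≡-Reasoning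
[1+k]*[1+n]C[1+k]≡[1+n]*nCk (suc n) (suc k) = begin
  (2 ℕ.+ k) ℕ.* (suc (suc n) C suc (suc k))
    ≡⟨ cong ((2 ℕ.+ k) ℕ.*_) (nCk+nC[k+1]≡[n+1]C[k+1] (suc n) (suc k)) ⟨
  (2 ℕ.+ k) ℕ.* (u ℕ.+ (suc n C suc (suc k)))
    ≡⟨ ℕ.*-distribˡ-+ (2 ℕ.+ k) u _ ⟩
  (u ℕ.+ suc k ℕ.* u) ℕ.+ (2 ℕ.+ k) ℕ.* (suc n C suc (suc k))
    ≡⟨ cong₂ (λ s t → (u ℕ.+ s) ℕ.+ t) ([1+k]*[1+n]C[1+k]≡[1+n]*nCk n k) ([1+k]*[1+n]C[1+k]≡[1+n]*nCk n (suc k)) ⟩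
  (u ℕ.+ suc n ℕ.* (n C k)) ℕ.+ suc n ℕ.* (n C suc k)
    ≡⟨ ℕ.+-assoc u _ _ ⟩
  u ℕ.+ (suc n ℕ.* (n C k) ℕ.+ suc n ℕ.* (n C suc k))
    ≡⟨ cong (u ℕ.+_) (ℕ.*-distribˡ-+ (suc n) (n C k) _) ⟨
  u ℕ.+ suc n ℕ.* ((n C k) ℕ.+ (n C suc k))
    ≡⟨ cong (λ s → u ℕ.+ suc n ℕ.* s) (nCk+nC[k+1]≡[n+1]C[k+1] n k) ⟩
  suc (suc n) ℕ.* u ∎
  where
  open ≡-Reasoning
  u : ℕ
  u = suc n C suc k

C-absorb : ∀ n k → + suc k * + (suc n C suc k) ≡ + suc n * + (n C k)
C-absorb n k = trans (sym (ℤ.pos-* (suc k) _))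
  (trans (cong +_ ([1+k]*[1+n]C[1+k]≡[1+n]*nCk n k)) (ℤ.pos-* (suc n) _))

C-step : ∀ n k → + suc k * + (n C suc k) ≡ (+ n - + k) * + (n C k)
C-step n k = begin
  + suc k * B                           ≡⟨ expand (+ suc k) A B ⟩
  + suc k * (A + B) - + suc k * A       ≡⟨ cong (λ s → + suc k * + s - + suc k * A) (nCk+nC[k+1]≡[n+1]C[k+1] n k) ⟩
  + suc k * + (suc n C suc k) - + suc k * A   ≡⟨ cong (_- + suc k * A) (C-absorb n k) ⟩
  (1ℤ + + n) * A - (1ℤ + + k) * A       ≡⟨ collect (+ n) (+ k) A ⟩
  (+ n - + k) * A                       ∎
  where
  open ≡-Reasoning
  A B : ℤ
  A = + (n C k)
  B = + (n C suc k)
  expand : ∀ k a b → k * b ≡ k * (a + b) - k * a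
  expand = solve-∀
  collect : ∀ n k a → (1ℤ + n) * a - (1ℤ + k) * a ≡ (n - k) * a
  collect = solve-∀

-- b k = (x + 1)(x + 2) ⋯ (x + k) / k!
record IsRising (x : ℤ) (b : ℕ → ℤ) : Set where
  field
    at-0   : b 0 ≡ 1ℤ
    at-suc : ∀ k → + suc k * b (suc k) ≡ (x + + suc k) * b k

open IsRising

C-isRising : ∀ n → IsRising (+ n) (λ k → + ((n ℕ.+ k) C k))
C-isRising n .at-0     = refl
C-isRising n .at-suc k = trans
  (cong (λ m → + suc k * + (m C suc k)) (ℕ.+-suc n k))
  (trans (C-absorb (n ℕ.+ k) k) (cong (_* + ((n ℕ.+ k) C k)) (cong +_ (sym (ℕ.+-suc n k)))))

-- Upper negation. It lets (N - 1 choose k) be treated like (n + k choose k), with -N in the place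
-- of n.
±C-isRising : ∀ n → IsRising (- (+ suc n)) (λ k → -1ℤ ^ k * + (n C k))
±C-isRising n .at-0     = refl
±C-isRising n .at-suc k = begin
  + suc k * (-1ℤ * s * + (n C suc k))         ≡⟨ regroup (+ suc k) s (+ (n C suc k)) ⟩
  - s * (+ suc k * + (n C suc k))             ≡⟨ cong (- s *_) (C-step n k) ⟩
  - s * ((+ n - + k) * + (n C k))             ≡⟨ regroup′ s (+ n) (+ k) (+ (n C k)) ⟩
  (- (1ℤ + + n) + (1ℤ + + k)) * (s * + (n C k))   ∎
  where
  open ≡-Reasoning
  s : ℤ
  s = -1ℤ ^ k
  regroup : ∀ k s b → k * (-1ℤ * s * b) ≡ - s * (k * b)
  regroup = solve-∀
  regroup′ : ∀ s n k a → - s * ((n - k) * a) ≡ (- (1ℤ + n) + (1ℤ + k)) * (s * a)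
  regroup′ = solve-∀

nCn+k≡ : ∀ n k → (n ℕ.+ k) C n ≡ (n ℕ.+ k) C k
nCn+k≡ n k = trans (nCk≡nC[n∸k] (ℕ.m≤m+n n k)) (cong ((n ℕ.+ k) C_) (ℕ.m+n∸m≡n n k))

n∣k*nCk : ∀ n k → + n ∣ + k * + (n C k)
n∣k*nCk n       zero    = divides 0ℤ refl
n∣k*nCk zero    (suc k) = divides 0ℤ (ℤ.*-zeroʳ (+ suc k))
n∣k*nCk (suc n) (suc k) = divides (+ (n C k)) (trans (C-absorb n k) (ℤ.*-comm (+ suc n) (+ (n C k))))

[n-k]*nCk : ∀ n k → (+ suc n - + k) * + (suc n C k) ≡ + suc n * + (n C k)
[n-k]*nCk n k = trans (sym (C-step (suc n) k)) (C-absorb n k)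

⌊*2/2⌋ : ∀ n → ⌊ n ℕ.* 2 /2⌋ ≡ n
⌊*2/2⌋ zero    = refl
⌊*2/2⌋ (suc n) = cong suc (⌊*2/2⌋ n)

⌊*2+/2⌋ : ∀ m n → ⌊ m ℕ.* 2 ℕ.+ n /2⌋ ≡ m ℕ.+ ⌊ n /2⌋
⌊*2+/2⌋ zero    n = refl
⌊*2+/2⌋ (suc m) n = cong suc (⌊*2+/2⌋ m n)

⌊/2⌋-< : ∀ {m n} → m < n ℕ.* 2 → ⌊ m /2⌋ < n
⌊/2⌋-< {m} {n} m<2n = ℕ.*-cancelʳ-< 2 ⌊ m /2⌋ n (ℕ.≤-<-trans (⌊n/2⌋*2≤n m) m<2n)
  where
  ⌊n/2⌋*2≤n : ∀ n → ⌊ n /2⌋ ℕ.* 2 ≤ n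
  ⌊n/2⌋*2≤n zero          = z≤n
  ⌊n/2⌋*2≤n (suc zero)    = z≤n
  ⌊n/2⌋*2≤n (suc (suc n)) = s≤s (s≤s (⌊n/2⌋*2≤n n))

-- Halving and division by p commute under the floor, both orders giving ⌊h / 2p⌋ for h = j p + i.
-- This carries the blocks of 2k over to k.
⌊/2⌋-block : ∀ p j i → i < p → ∃[ i′ ] i′ < p × ⌊ j ℕ.* p ℕ.+ i /2⌋ ≡ ⌊ j /2⌋ ℕ.* p ℕ.+ i′
⌊/2⌋-block p j i i<p with parity j
... | inj₁ (m , refl) = ⌊ i /2⌋ , ⌊/2⌋-< (ℕ.<-≤-trans i<p (ℕ.m≤m*n p 2)) ,
  trans (cong ⌊_/2⌋ (regroup m p i)) (trans (⌊*2+/2⌋ (m ℕ.* p) i) (cong (λ k → k ℕ.* p ℕ.+ ⌊ i /2⌋) (sym (⌊*2/2⌋ m))))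
  where
  regroup : ∀ m p i → m ℕ.* 2 ℕ.* p ℕ.+ i ≡ m ℕ.* p ℕ.* 2 ℕ.+ i
  regroup = ℕ-Solver.solve-∀
... | inj₂ (m , refl) = ⌊ p ℕ.+ i /2⌋ ,
  ⌊/2⌋-< (subst (p ℕ.+ i <_) (p+p≡p*2 p) (ℕ.+-monoʳ-< p i<p)) ,
  trans (cong ⌊_/2⌋ (regroup m p i)) (trans (⌊*2+/2⌋ (m ℕ.* p) (p ℕ.+ i))
    (cong (λ k → k ℕ.* p ℕ.+ ⌊ p ℕ.+ i /2⌋) (sym (⌊1+*2/2⌋ m))))
  where
  p+p≡p*2 : ∀ p → p ℕ.+ p ≡ p ℕ.* 2
  p+p≡p*2 = ℕ-Solver.solve-∀
  regroup : ∀ m p i → suc (m ℕ.* 2) ℕ.* p ℕ.+ i ≡ m ℕ.* p ℕ.* 2 ℕ.+ (p ℕ.+ i)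
  regroup = ℕ-Solver.solve-∀
  ⌊1+*2/2⌋ : ∀ m → ⌊ suc (m ℕ.* 2) /2⌋ ≡ m
  ⌊1+*2/2⌋ zero    = refl
  ⌊1+*2/2⌋ (suc m) = cong suc (⌊1+*2/2⌋ m)

+sum≡∑ : ∀ (f : ℕ → ℕ) n → + sum (applyUpTo f n) ≡ ∑ n (λ i → + f i)
+sum≡∑ f zero    = refl
+sum≡∑ f (suc n) = trans (cong (λ s → + f 0 + s) (+sum≡∑ (f ∘ suc) n)) (sym (∑-first n))

-- Meant for a block of p consecutive indices, of which only the first is a multiple of p: its term
-- gives `x`, and the remainder `g` vanishes there.
∑-first-cong : ∀ n → .{{ℕ.NonZero n}} → f 0 ≅ x [ M ] → g 0 ≡ 0ℤ →
               (∀ i → suc i < n → f (suc i) ≅ g (suc i) [ M ]) → ∑ n f ≅ x + ∑ n g [ M ]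
∑-first-cong {f = f} {x = x} {M = M} {g = g} (suc n) f0≅ g0≡ eq = begin
  ∑ (suc n) f                              ≡⟨ ∑-first n ⟩
  f 0 + ∑ n (λ i → f (suc i))              ≈⟨ +-cong f0≅ (∑-cong n λ i i<n → eq i (s≤s i<n)) ⟩
  x + ∑ n (λ i → g (suc i))                ≡⟨ cong (λ y → x + y) (ℤ.+-identityˡ (∑ n λ i → g (suc i))) ⟨
  x + (0ℤ + ∑ n (λ i → g (suc i)))         ≡⟨ cong (λ y → x + (y + ∑ n λ i → g (suc i))) g0≡ ⟨
  x + (g 0 + ∑ n (λ i → g (suc i)))        ≡⟨ cong (λ y → x + y) (∑-first n) ⟨
  x + ∑ (suc n) g                          ∎
  where open ≅-Reasoning M

-- Units modulo powers of p

module _ (p : ℕ) (prime : Prime p) where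

  private
    instance
      p≢0 : ℕ.NonZero p
      p≢0 = prime⇒nonZero prime

    P : ℤ
    P = + p

  -- An inverse modulo p is all that is stored; `inverse` lifts it to any power of p, so one witness
  -- serves every modulus.
  record Unit (x : ℤ) : Set where
    constructor _,_
    field
      inverse-mod-p : ℤ
      isInverse     : x * inverse-mod-p ≅ 1ℤ [ P ]

  -- If u v ≡ 1 (mod p) and u w ≡ 1 (mod pᵏ), then (1 − u v)(1 − u w) ≡ 0 (mod pᵏ⁺¹).
  inverse : Unit x → ∀ k → ∃[ y ] x * y ≅ 1ℤ [ P ^ k ]
  inverse u zero = 0ℤ , ∣-diff (1∣ _)
  inverse {x} u@(v , xv≅1) (suc k) with inverse u k
  ... | w , xw≅1 = v + w - x * v * w , ∣-diff
    (subst (P ^ suc k ∣_) (expand x v w) (∣m⇒∣-m (*-∣ (diff xv≅1) (diff xw≅1))))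
    where
    expand : ∀ x v w → - ((x * v - 1ℤ) * (x * w - 1ℤ)) ≡ x * (v + w - x * v * w) - 1ℤ
    expand = solve-∀

  Unit-* : Unit x → Unit y → Unit (x * y)
  Unit-* {x} {y} (v , xv≅1) (w , yw≅1) = v * w ,
    ≅-trans (≡⇒≅ (regroup x v y w)) (*-cong xv≅1 yw≅1)
    where
    regroup : ∀ x v y w → (x * y) * (v * w) ≡ (x * v) * (y * w)
    regroup = solve-∀

  Unit-1 : Unit 1ℤ
  Unit-1 = 1ℤ , ≅-refl

  Unit-resp-≅ : x ≅ y [ P ] → Unit y → Unit x
  Unit-resp-≅ x≅y (v , yv≅1) = v , ≅-trans (*-congʳ v x≅y) yv≅1

  Unit-∏ : ∀ n → (∀ i → Unit (f i)) → Unit (∏ n f)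
  Unit-∏ zero    u = Unit-1
  Unit-∏ (suc n) u = Unit-* (Unit-∏ n u) (u n)

  Unit-pos : ∀ {n} → ¬ p ℕ.∣ n → Unit (+ n)
  Unit-pos {n} p∤n with coprime-Bézout coprime
    where
    coprime : Coprime p n
    coprime (d∣p , d∣n) with prime⇒irreducible prime d∣p
    ... | inj₁ d≡1  = d≡1
    ... | inj₂ refl = contradiction d∣n p∤n
  ... | Bézout.+- s t eq = - (+ t) , ∣-diff (divides (- (+ s)) (begin
      + n * - (+ t) - 1ℤ      ≡⟨ rearrange (+ n) (+ t) ⟩
      - (1ℤ + + t * + n)      ≡⟨ cong (λ x → - (1ℤ + x)) (ℤ.pos-* t n) ⟨
      - (+ (1 ℕ.+ t ℕ.* n))   ≡⟨ cong (λ k → - (+ k)) eq ⟩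
      - (+ (s ℕ.* p))         ≡⟨ cong -_ (ℤ.pos-* s p) ⟩
      - (+ s * P)             ≡⟨ ℤ.neg-distribˡ-* (+ s) P ⟩
      - (+ s) * P             ∎))
    where
    open ≡-Reasoning
    rearrange : ∀ n t → n * - t - 1ℤ ≡ - (1ℤ + t * n)
    rearrange = solve-∀
  ... | Bézout.-+ s t eq = + t , ∣-diff (divides (+ s) (begin
      + n * + t - 1ℤ              ≡⟨ cong (_- 1ℤ) (ℤ.*-comm (+ n) (+ t)) ⟩
      + t * + n - 1ℤ              ≡⟨ cong (_- 1ℤ) (ℤ.pos-* t n) ⟨
      + (t ℕ.* n) - 1ℤ            ≡⟨ cong (λ k → + k - 1ℤ) eq ⟨
      + (1 ℕ.+ s ℕ.* p) - 1ℤ      ≡⟨ cancel (+ (s ℕ.* p)) ⟩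
      + (s ℕ.* p)                 ≡⟨ ℤ.pos-* s p ⟩
      + s * P                     ∎))
    where
    open ≡-Reasoning
    cancel : ∀ x → (1ℤ + x) - 1ℤ ≡ x
    cancel = solve-∀

  Unit-cancel-∣ : Unit x → ∀ k → P ^ k ∣ x * y → P ^ k ∣ y
  Unit-cancel-∣ {x} {y} u k p with inverse u k
  ... | v , xv≅1 = ∣-resp-≅ y≅vxy (∣n⇒∣m*n v p)
    where
    open ≅-Reasoning (P ^ k)
    y≅vxy : y ≅ v * (x * y) [ P ^ k ]
    y≅vxy = begin
      y              ≡⟨ ℤ.*-identityˡ y ⟨
      1ℤ * y         ≈⟨ *-congʳ y xv≅1 ⟨
      x * v * y      ≡⟨ regroup x v y ⟩
      v * (x * y)    ∎
      where
      regroup : ∀ x v y → x * v * y ≡ v * (x * y)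
      regroup = solve-∀

  Unit-cancel : Unit x → ∀ k → x * y ≅ x * a [ P ^ k ] → y ≅ a [ P ^ k ]
  Unit-cancel {x} {y} {a} u k (∣-diff p) =
    ∣-diff (Unit-cancel-∣ u k (subst (P ^ k ∣_) (factor x y a) p))
    where
    factor : ∀ x y z → x * y - x * z ≡ x * (y - z)
    factor = solve-∀

  -- Inverse squares modulo powers of p

  opaque
    -- `inv² k i` stands for i⁻² modulo pᵏ. The value 0 at multiples of p turns sums over the i
    -- prime to p into sums over whole intervals.
    inv² : ℕ → ℕ → ℤ
    inv² k i with p ℕ.∣? i
    ... | yes _  = 0ℤ
    ... | no p∤i = proj₁ (inverse (Unit-* (Unit-pos p∤i) (Unit-pos p∤i)) k)

    inv²-∣ : ∀ k {i} → p ℕ.∣ i → inv² k i ≡ 0ℤ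
    inv²-∣ k {i} p∣i with p ℕ.∣? i
    ... | yes _  = refl
    ... | no p∤i = contradiction p∣i p∤i

    inv²-∤ : ∀ k {i} → ¬ p ℕ.∣ i → (+ i * + i) * inv² k i ≅ 1ℤ [ P ^ k ]
    inv²-∤ k {i} p∤i with p ℕ.∣? i
    ... | yes p∣i = contradiction p∣i p∤i
    ... | no p∤i′ = proj₂ (inverse (Unit-* (Unit-pos p∤i′) (Unit-pos p∤i′)) k)

  inv²-unique : ∀ {k l i} → k ≤ l → ¬ p ℕ.∣ i →
                (+ i * + i) * x ≅ 1ℤ [ P ^ k ] → x ≅ inv² l i [ P ^ k ]
  inv²-unique {k = k} {l} k≤l p∤i eq = Unit-cancel (Unit-* (Unit-pos p∤i) (Unit-pos p∤i)) k
    (≅-trans eq (≅-sym (≅-weaken (^-monoʳ-∣ P k≤l) (inv²-∤ l p∤i))))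

  inv²-cong : ∀ {k l i j} → k ≤ l → (p ℕ.∣ i → p ℕ.∣ j) → (p ℕ.∣ j → p ℕ.∣ i) →
              + i * + i ≅ + j * + j [ P ^ k ] → inv² l i ≅ inv² l j [ P ^ k ]
  inv²-cong {k} {l} {i} {j} k≤l i⇒j j⇒i eq with p ℕ.∣? j
  ... | yes p∣j = ≡⇒≅ (trans (inv²-∣ l (j⇒i p∣j)) (sym (inv²-∣ l p∣j)))
  ... | no p∤j  = inv²-unique k≤l p∤j (≅-trans (*-congʳ (inv² l i) (≅-sym eq))
    (≅-weaken (^-monoʳ-∣ P k≤l) (inv²-∤ l (p∤j ∘ i⇒j))))

  p∣p^1+ : ∀ k → p ℕ.∣ p ℕ.^ suc k
  p∣p^1+ k = ℕ.m∣m*n (p ℕ.^ k)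

  inv²-reflect : ∀ {k l i} → suc k ≤ l → i ≤ p ℕ.^ suc k →
                 inv² l (p ℕ.^ suc k ∸ i) ≅ inv² l i [ P ^ suc k ]
  inv²-reflect {k} {l} {i} k<l i≤q = inv²-cong k<l
    (λ p∣q∸i → ℕ.∣m+n∣m⇒∣n (subst (p ℕ.∣_) (sym (ℕ.m∸n+n≡m i≤q)) (p∣p^1+ k)) p∣q∸i)
    (ℕ.∣m+n∣m⇒∣n (subst (p ℕ.∣_) (sym (ℕ.m+[n∸m]≡n i≤q)) (p∣p^1+ k)))
    (subst₂ (λ a b → a * a ≅ + i * + i [ b ]) (sym (pos-∸ i≤q)) (pos-^ p (suc k))
      (∣-diff (divides (+ (p ℕ.^ suc k) - + 2 * + i) (expand (+ (p ℕ.^ suc k)) (+ i)))))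
    where
    expand : ∀ q i → (q - i) * (q - i) - i * i ≡ (q - + 2 * i) * q
    expand = solve-∀

  inv²-shift : ∀ {k l} j i → suc k ≤ l →
               inv² l (j ℕ.* p ℕ.^ suc k ℕ.+ i) ≅ inv² l i [ P ^ suc k ]
  inv²-shift {k} {l} j i k<l = inv²-cong k<l
    (λ p∣jq+i → ℕ.∣m+n∣m⇒∣n p∣jq+i p∣jq)
    (ℕ.∣m∣n⇒∣m+n p∣jq)
    (subst₂ (λ a b → (a + + i) * (a + + i) ≅ + i * + i [ b ]) (sym (ℤ.pos-* j (p ℕ.^ suc k))) (pos-^ p (suc k))
      (∣-diff (divides (+ j * (+ j * + (p ℕ.^ suc k) + + 2 * + i)) (expand (+ j) (+ (p ℕ.^ suc k)) (+ i)))))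
    where
    p∣jq : p ℕ.∣ j ℕ.* p ℕ.^ suc k
    p∣jq = ℕ.∣n⇒∣m*n j (p∣p^1+ k)
    expand : ∀ j q i → (j * q + i) * (j * q + i) - i * i ≡ j * (j * q + + 2 * i) * q
    expand = solve-∀

  -- Rising factorials without the multiples of p

  opaque
    factor : ℤ → ℕ → ℤ
    factor x i with p ℕ.∣? i
    ... | yes _ = 1ℤ
    ... | no _  = x + + i

    factor-∣ : ∀ {i} → p ℕ.∣ i → factor x i ≡ 1ℤ
    factor-∣ {i = i} p∣i with p ℕ.∣? i
    ... | yes _  = refl
    ... | no p∤i = contradiction p∣i p∤i

    factor-∤ : ∀ {i} → ¬ p ℕ.∣ i → factor x i ≡ x + + i
    factor-∤ {i = i} p∤i with p ℕ.∣? i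
    ... | yes p∣i = contradiction p∣i p∤i
    ... | no _    = refl

    factor-cong : ∀ i → x ≅ y [ M ] → factor x i ≅ factor y i [ M ]
    factor-cong i x≅y with p ℕ.∣? i
    ... | yes _ = ≅-refl
    ... | no _  = +-cong x≅y (≅-refl {+ i})

  factor₀-unit : ∀ i → Unit (factor 0ℤ i)
  factor₀-unit i with p ℕ.∣? i
  ... | yes p∣i = subst Unit (sym (factor-∣ p∣i)) Unit-1
  ... | no p∤i  = subst Unit (sym (trans (factor-∤ p∤i) (ℤ.+-identityˡ (+ i)))) (Unit-pos p∤i)

  -- The index 0 contributes 1, since p ∣ 0; with it the range is symmetric under i ↦ k - i, which
  -- the pairing in `Jacobsthal` uses.
  factors : ℤ → ℕ → ℤ
  factors x k = ∏ (suc k) (factor x)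

  factors-zero : ∀ x → factors x 0 ≡ 1ℤ
  factors-zero x = cong (1ℤ *_) (factor-∣ (p ℕ.∣0))

  factors₀-unit : ∀ k → Unit (factors 0ℤ k)
  factors₀-unit k = Unit-∏ (suc k) factor₀-unit

  factors-cong : ∀ k → x ≅ y [ M ] → factors x k ≅ factors y k [ M ]
  factors-cong k x≅y = ∏-cong (suc k) λ i _ → factor-cong i x≅y

  module _ {y} {b b′ : ℕ → ℤ} (bRising : IsRising (P * y) b) (b′Rising : IsRising y b′) where

    private
      U V : ℕ → ℤ
      U = factors 0ℤ
      V = factors (P * y)

      -- Here `j` counts the multiples of p among 1, ..., `k`; it advances only when p divides the
      -- next index.
      Claim : ℕ → ℕ → Set
      Claim k j = b k * U k ≡ V k * b′ j

      claim-zero : Claim 0 0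
      claim-zero = trans (cong₂ _*_ (bRising .at-0) (factors-zero 0ℤ))
        (sym (cong₂ _*_ (factors-zero (P * y)) (b′Rising .at-0)))

      claim-∤ : ∀ {k j} → ¬ p ℕ.∣ suc k → Claim k j → Claim (suc k) j
      claim-∤ {k} {j} p∤ eq = begin
        b (suc k) * (U k * factor 0ℤ (suc k))    ≡⟨ cong (λ t → b (suc k) * (U k * t)) (factor-∤ p∤) ⟩
        b (suc k) * (U k * (0ℤ + + suc k))       ≡⟨ regroup (b (suc k)) (U k) (+ suc k) ⟩
        U k * (+ suc k * b (suc k))              ≡⟨ cong (U k *_) (bRising .at-suc k) ⟩
        U k * ((P * y + + suc k) * b k)          ≡⟨ regroup′ (U k) (P * y + + suc k) (b k) ⟩
        (P * y + + suc k) * (b k * U k)          ≡⟨ cong ((P * y + + suc k) *_) eq ⟩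
        (P * y + + suc k) * (V k * b′ j)         ≡⟨ regroup″ (P * y + + suc k) (V k) (b′ j) ⟩
        (V k * (P * y + + suc k)) * b′ j         ≡⟨ cong (λ t → (V k * t) * b′ j) (factor-∤ p∤) ⟨
        (V k * factor (P * y) (suc k)) * b′ j    ∎
        where
        open ≡-Reasoning
        regroup : ∀ b u k → b * (u * (0ℤ + k)) ≡ u * (k * b)
        regroup = solve-∀
        regroup′ : ∀ u t b → u * (t * b) ≡ t * (b * u)
        regroup′ = solve-∀
        regroup″ : ∀ t v b → t * (v * b) ≡ (v * t) * b
        regroup″ = solve-∀

      -- At k + 1 = (j + 1) p the quotient (P y + k + 1) / (k + 1) reduces to (y + j + 1) / (j + 1),
      -- the next factor of `b′`. Multiplying by k + 1 avoids the fractions.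
      claim-∣ : ∀ {k j} → suc k ≡ suc j ℕ.* p → Claim k j → Claim (suc k) (suc j)
      claim-∣ {k} {j} 1+k≡ eq = ℤ.*-cancelˡ-≡ (+ suc k) _ _ (begin
        + suc k * (b (suc k) * (U k * factor 0ℤ (suc k)))   ≡⟨ cong (λ t → + suc k * (b (suc k) * (U k * t))) (factor-∣ p∣) ⟩
        + suc k * (b (suc k) * (U k * 1ℤ))                  ≡⟨ regroup (+ suc k) (b (suc k)) (U k) ⟩
        (+ suc k * b (suc k)) * U k                         ≡⟨ cong (_* U k) (bRising .at-suc k) ⟩
        ((P * y + + suc k) * b k) * U k                     ≡⟨ ℤ.*-assoc (P * y + + suc k) (b k) (U k) ⟩
        (P * y + + suc k) * (b k * U k)                     ≡⟨ cong₂ (λ s t → (P * y + s) * t) +1+k≡ eq ⟩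
        (P * y + + suc j * P) * (V k * b′ j)                ≡⟨ regroup′ P y (+ suc j) (V k) (b′ j) ⟩
        P * V k * ((y + + suc j) * b′ j)                    ≡⟨ cong (P * V k *_) (b′Rising .at-suc j) ⟨
        P * V k * (+ suc j * b′ (suc j))                    ≡⟨ regroup″ P (V k) (+ suc j) (b′ (suc j)) ⟩
        (+ suc j * P) * ((V k * 1ℤ) * b′ (suc j))           ≡⟨ cong₂ (λ s t → s * ((V k * t) * b′ (suc j))) +1+k≡ (factor-∣ p∣) ⟨
        + suc k * ((V k * factor (P * y) (suc k)) * b′ (suc j))   ∎)
        where
        open ≡-Reasoning
        p∣ : p ℕ.∣ suc k
        p∣ = ℕ.divides (suc j) 1+k≡
        +1+k≡ : + suc k ≡ + suc j * P
        +1+k≡ = trans (cong +_ 1+k≡) (ℤ.pos-* (suc j) p)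
        regroup : ∀ k b u → k * (b * (u * 1ℤ)) ≡ (k * b) * u
        regroup = solve-∀
        regroup′ : ∀ p y j v b → (p * y + j * p) * (v * b) ≡ p * v * ((y + j) * b)
        regroup′ = solve-∀
        regroup″ : ∀ p v j b → p * v * (j * b) ≡ (j * p) * ((v * 1ℤ) * b)
        regroup″ = solve-∀

    -- The multiples of p among the factors of b make up b′.
    rising-factors : ∀ j i → i < p →
      b (j ℕ.* p ℕ.+ i) * factors 0ℤ (j ℕ.* p ℕ.+ i) ≡ factors (P * y) (j ℕ.* p ℕ.+ i) * b′ j
    rising-factors zero zero _ = claim-zero
    rising-factors (suc j) zero _ = subst (λ k → Claim k (suc j)) (sym k≡)
      (claim-∣ (trans (sym k≡) (ℕ.+-identityʳ (suc j ℕ.* p)))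
        (rising-factors j (ℕ.pred p) (ℕ.≤-reflexive (ℕ.suc-pred p))))
      where
      k≡ : suc j ℕ.* p ℕ.+ 0 ≡ suc (j ℕ.* p ℕ.+ ℕ.pred p)
      k≡ = trans (ℕ.+-identityʳ (suc j ℕ.* p)) (trans (ℕ.+-comm p (j ℕ.* p))
        (trans (cong (j ℕ.* p ℕ.+_) (sym (ℕ.suc-pred p))) (ℕ.+-suc (j ℕ.* p) (ℕ.pred p))))
    rising-factors j (suc i) 1+i<p = subst (λ k → Claim k j) (sym (ℕ.+-suc (j ℕ.* p) i))
      (claim-∤ (λ p∣ → ℕ.>⇒∤ 1+i<p (ℕ.∣m+n∣m⇒∣n (subst (p ℕ.∣_) (sym (ℕ.+-suc (j ℕ.* p) i)) p∣) (ℕ.n∣m*n j)))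
        (rising-factors j i (ℕ.<-trans (ℕ.n<1+n i) 1+i<p)))

    -- The numerators P y + i and the denominators i with p ∤ i agree modulo pᵏ, and their products
    -- cancel because they are units.
    rising-cong : ∀ k j i → i < p → P ^ k ∣ P * y → b (j ℕ.* p ℕ.+ i) ≅ b′ j [ P ^ k ]
    rising-cong k j i i<p p∣ = Unit-cancel (factors₀-unit n) k (begin
      factors 0ℤ n * b n          ≡⟨ ℤ.*-comm (factors 0ℤ n) (b n) ⟩
      b n * factors 0ℤ n          ≡⟨ rising-factors j i i<p ⟩
      factors (P * y) n * b′ j    ≈⟨ *-congʳ (b′ j) (factors-cong n (∣⇒≅0 p∣)) ⟩
      factors 0ℤ n * b′ j         ∎)
      where
      open ≅-Reasoning (P ^ k)
      n : ℕ
      n = j ℕ.* p ℕ.+ i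

  n*p≡p*n : ∀ n → + (n ℕ.* p) ≡ P * + n
  n*p≡p*n n = trans (ℤ.pos-* n p) (ℤ.*-comm (+ n) P)

  C-isRising-* : ∀ n → IsRising (P * + n) (λ k → + ((n ℕ.* p ℕ.+ k) C k))
  C-isRising-* n = subst (λ x → IsRising x (λ k → + ((n ℕ.* p ℕ.+ k) C k))) (n*p≡p*n n) (C-isRising (n ℕ.* p))

  C-cong : ∀ n k j i → i < p → P ^ k ∣ + (n ℕ.* p) →
           + ((n ℕ.* p ℕ.+ (j ℕ.* p ℕ.+ i)) C (j ℕ.* p ℕ.+ i)) ≅ + ((n ℕ.+ j) C j) [ P ^ k ]
  C-cong n k j i i<p p∣ = rising-cong (C-isRising-* n) (C-isRising n)
    k j i i<p (subst (P ^ k ∣_) (n*p≡p*n n) p∣)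

  -- The square removes the signs of the binomial coefficients of −n.
  C²-cong : ∀ {n n′} k j i → suc n′ ≡ suc n ℕ.* p → i < p → P ^ k ∣ + suc n′ →
            (+ (n′ C (j ℕ.* p ℕ.+ i))) ^ 2 ≅ (+ (n C j)) ^ 2 [ P ^ k ]
  C²-cong {n} {n′} k j i 1+n′≡ i<p p∣ = begin
    (+ (n′ C l)) ^ 2                  ≡⟨ ±-square l (+ (n′ C l)) ⟨
    (-1ℤ ^ l * + (n′ C l)) ^ 2      ≈⟨ ^-cong 2 (rising-cong
                                         (subst (λ x → IsRising x (λ k → -1ℤ ^ k * + (n′ C k))) np≡ (±C-isRising n′)) (±C-isRising n)
                                         k j i i<p (subst (P ^ k ∣_) np≡ (∣m⇒∣-m p∣))) ⟩
    (-1ℤ ^ j * + (n C j)) ^ 2       ≡⟨ ±-square j (+ (n C j)) ⟩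
    (+ (n C j)) ^ 2                   ∎
    where
    open ≅-Reasoning (P ^ k)
    l : ℕ
    l = j ℕ.* p ℕ.+ i
    ±-square : ∀ k x → (-1ℤ ^ k * x) ^ 2 ≡ x ^ 2
    ±-square zero    x = cong (_^ 2) (ℤ.*-identityˡ x)
    ±-square (suc k) x = trans (negate (-1ℤ ^ k) x) (±-square k x)
      where
      negate : ∀ s x → (-1ℤ * s * x) * ((-1ℤ * s * x) * 1ℤ) ≡ (s * x) * ((s * x) * 1ℤ)
      negate = solve-∀
    np≡ : - (+ suc n′) ≡ P * - (+ suc n)
    np≡ = trans (cong (λ m → - (+ m)) 1+n′≡)
      (trans (cong -_ (n*p≡p*n (suc n))) (ℤ.neg-distribʳ-* P (+ suc n)))

  -- Sums of inverse squares over blocks and over their even members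

  module _ (5≤p : 5 ≤ p) where

    p∤ : ∀ n .{{_ : ℕ.NonZero n}} → n < 5 → ¬ p ℕ.∣ n
    p∤ n n<5 p∣n = ℕ.<-irrefl refl (ℕ.<-≤-trans n<5 (ℕ.≤-trans 5≤p (ℕ.∣⇒≤ p∣n)))

    4*inv²-double : ∀ k i → + 4 * inv² k (i ℕ.* 2) ≅ inv² k i [ P ^ k ]
    4*inv²-double k i with p ℕ.∣? i
    ... | yes p∣i = ≡⇒≅ (trans (cong (+ 4 *_) (inv²-∣ k (ℕ.∣m⇒∣m*n 2 p∣i))) (sym (inv²-∣ k p∣i)))
    ... | no p∤i  = inv²-unique ℕ.≤-refl p∤i (≅-trans (≡⇒≅ regroup) (inv²-∤ k p∤2i))
      where
      p∤2i : ¬ p ℕ.∣ i ℕ.* 2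
      p∤2i p∣2i = [ p∤i , p∤ 2 (s≤s (s≤s (s≤s z≤n))) ]′ (euclidsLemma i 2 prime p∣2i)
      expand : ∀ i x → (i * i) * (+ 4 * x) ≡ ((i * + 2) * (i * + 2)) * x
      expand = solve-∀
      regroup : (+ i * + i) * (+ 4 * inv² k (i ℕ.* 2)) ≡ (+ (i ℕ.* 2) * + (i ℕ.* 2)) * inv² k (i ℕ.* 2)
      regroup = trans (expand (+ i) (inv² k (i ℕ.* 2)))
        (cong (λ x → (x * x) * inv² k (i ℕ.* 2)) (sym (ℤ.pos-* i 2)))

    p^-odd : ∀ k → ∃[ v ] p ℕ.^ k ≡ suc (v ℕ.* 2)
    p^-odd k with parity (p ℕ.^ k)
    ... | inj₂ odd       = odd
    ... | inj₁ (m , eq) = contradiction (ℕ.divides m eq) (2∤p^ k)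
      where
      2∤p^ : ∀ k → ¬ 2 ℕ.∣ p ℕ.^ k
      2∤p^ zero 2∣1 with ℕ.∣1⇒≡1 2∣1
      ... | ()
      2∤p^ (suc k) 2∣p^ with euclidsLemma p (p ℕ.^ k) prime[2] 2∣p^
      ... | inj₂ 2∣p^k = 2∤p^ k 2∣p^k
      ... | inj₁ 2∣p with prime⇒irreducible prime 2∣p
      ... | inj₁ ()
      ... | inj₂ refl = contradiction 5≤p (ℕ.<⇒≱ (s≤s (s≤s (s≤s z≤n))))

    -- Write E, O, H for the sums over the even i, the odd i and the first half of 0 ≤ i ≤ q = pᵏ⁺¹.
    -- The reflection i ↦ q − i gives E ≡ O and E + O ≡ 2H, and i ↦ 2i gives 4E ≡ H; so 3E ≡ 0.
    module HalfSums (k l v : ℕ) (k<l : suc k ≤ l) (q≡ : p ℕ.^ suc k ≡ suc (v ℕ.* 2)) where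

      private
        -- Since q + 1 = 2u, the range 0 ≤ i ≤ q splits into u even and u odd indices, and also into
        -- two halves of length u.
        u : ℕ
        u = suc v
        F : ℕ → ℤ
        F = inv² l
        E O H : ℤ
        E = ∑ u (λ i → F (i ℕ.* 2))
        O = ∑ u (λ i → F (suc (i ℕ.* 2)))
        H = ∑ u F

        reflect : ∀ {i j} → i ℕ.+ j ≡ suc (v ℕ.* 2) → F i ≅ F j [ P ^ suc k ]
        reflect {i} {j} eq = subst (λ n → F n ≅ F j [ P ^ suc k ])
          (trans (cong (_∸ j) q≡i+j) (ℕ.m+n∸n≡m i j))
          (inv²-reflect k<l (subst (j ≤_) (sym q≡i+j) (ℕ.m≤n+m j i)))
          where
          q≡i+j : p ℕ.^ suc k ≡ i ℕ.+ j
          q≡i+j = trans q≡ (sym eq)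

        O≅E : O ≅ E [ P ^ suc k ]
        O≅E = ≅-trans (≡⇒≅ (∑-reverse u)) (∑-cong u λ i i<u → reflect
          (cong suc (trans (sym (ℕ.*-distribʳ-+ 2 (v ∸ i) i)) (cong (ℕ._* 2) (ℕ.m∸n+n≡m (ℕ.≤-pred i<u))))))

        E+O≅H+H : E + O ≅ H + H [ P ^ suc k ]
        E+O≅H+H = begin
          E + O                                ≡⟨ ∑-even-odd u ⟨
          ∑ (u ℕ.* 2) F                        ≡⟨ cong (λ n → ∑ n F) u*2≡u+u ⟩
          ∑ (u ℕ.+ u) F                        ≡⟨ ∑-split u u ⟩
          H + ∑ u (λ i → F (u ℕ.+ i))          ≡⟨ cong (λ x → H + x) (∑-reverse u) ⟩
          H + ∑ u (λ i → F (u ℕ.+ (v ∸ i)))    ≈⟨ +-cong (≅-refl {H}) (∑-cong u λ i i<u → reflect (u+v≡ i (ℕ.≤-pred i<u))) ⟩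
          H + H                                ∎
          where
          open ≅-Reasoning (P ^ suc k)
          *2≡+ : ∀ n → n ℕ.* 2 ≡ n ℕ.+ n
          *2≡+ n = trans (ℕ.*-comm n 2) (cong (n ℕ.+_) (ℕ.+-identityʳ n))
          u*2≡u+u : u ℕ.* 2 ≡ u ℕ.+ u
          u*2≡u+u = *2≡+ u
          u+v≡ : ∀ i → i ≤ v → u ℕ.+ (v ∸ i) ℕ.+ i ≡ suc (v ℕ.* 2)
          u+v≡ i i≤v = cong suc (trans (ℕ.+-assoc v (v ∸ i) i)
            (trans (cong (v ℕ.+_) (ℕ.m∸n+n≡m i≤v)) (sym (*2≡+ v))))

        4*E≅H : + 4 * E ≅ H [ P ^ suc k ]
        4*E≅H = ≅-trans (≡⇒≅ (*-distribˡ-∑ (+ 4) u))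
          (∑-cong u λ i _ → ≅-weaken (^-monoʳ-∣ P k<l) (4*inv²-double l i))

      ∑-even-inv² : P ^ suc k ∣ ∑ u (λ i → inv² l (i ℕ.* 2))
      -- The relations are combined without dividing by 2, so the multiple of E obtained is 6 E; 2
      -- and 3 are units because p ≥ 5.
      ∑-even-inv² = Unit-cancel-∣ {x = + 6} (Unit-* (Unit-pos (p∤ 2 (s≤s (s≤s (s≤s z≤n))))) (Unit-pos (p∤ 3 (s≤s (s≤s (s≤s (s≤s z≤n)))))))
        (suc k) (subst (P ^ suc k ∣_) (combine E O H)
          (∣m∣n⇒∣m+n (∣m∣n⇒∣m+n (∣m⇒∣-m (diff E+O≅H+H)) (diff O≅E)) (∣n⇒∣m*n (+ 2) (diff 4*E≅H))))
        where
        combine : ∀ E O H → (- ((E + O) - (H + H)) + (O - E)) + + 2 * (+ 4 * E - H) ≡ + 6 * E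
        combine = solve-∀

      ∑-odd-inv² : P ^ suc k ∣ ∑ u (λ i → inv² l (suc (i ℕ.* 2)))
      ∑-odd-inv² = ∣-resp-≅ O≅E ∑-even-inv²

    -- The extra summand i = pᵏ⁺¹ vanishes and makes the number of summands even.
    ∑-inv²-extend : ∀ k l {v} (w : ℕ → ℤ) → p ℕ.^ suc k ≡ suc (v ℕ.* 2) →
                    ∑ (p ℕ.^ suc k) (λ i → w i * inv² l i) ≡ ∑ (suc v ℕ.* 2) (λ i → w i * inv² l i)
    ∑-inv²-extend k l {v} w q≡ = trans
      (sym (trans (cong (λ x → ∑ q (λ i → w i * inv² l i) + x)
        (trans (cong (w q *_) (inv²-∣ l (p∣p^1+ k))) (ℤ.*-zeroʳ (w q)))) (ℤ.+-identityʳ _)))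
      (cong (λ n → ∑ n (λ i → w i * inv² l i)) (cong suc q≡))
      where
      q : ℕ
      q = p ℕ.^ suc k

    evenInv² : ℕ → ℕ → ℤ
    evenInv² l i = even i * inv² l i

    -- Modulo pᵏ the inverse squares depend only on the offset in the block. The even members have
    -- even offsets if the block starts at an even number and odd offsets otherwise; both half sums
    -- vanish.
    ∑-evenInv²-block : ∀ k l j → k ≤ l →
                       P ^ k ∣ ∑ (p ℕ.^ k) (λ i → evenInv² l (j ℕ.* p ℕ.^ k ℕ.+ i))
    ∑-evenInv²-block zero    l j k≤l = 1∣ _
    ∑-evenInv²-block (suc k) l j k≤l with p^-odd (suc k) | parity (j ℕ.* p ℕ.^ suc k)
    ... | v , q≡ | inj₁ (m , z≡) = ∣-resp-≅
      (∑-cong (p ℕ.^ suc k) λ i _ → *-cong {c = inv² l (j ℕ.* p ℕ.^ suc k ℕ.+ i)}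
        (≡⇒≅ (trans (cong (λ z → even (z ℕ.+ i)) z≡) (even-*2+ m i))) (inv²-shift j i k≤l))
      (subst (P ^ suc k ∣_)
        (sym (trans (∑-inv²-extend k l {v} even q≡) (∑-even {inv² l} (suc v))))
        (HalfSums.∑-even-inv² k l v k≤l q≡))
    ... | v , q≡ | inj₂ (m , z≡) = ∣-resp-≅
      (∑-cong (p ℕ.^ suc k) λ i _ → *-cong {c = inv² l (j ℕ.* p ℕ.^ suc k ℕ.+ i)}
        (≡⇒≅ (trans (cong (λ z → even (z ℕ.+ i)) z≡) (cong (λ x → 1ℤ - x) (even-*2+ m i)))) (inv²-shift j i k≤l))
      (subst (P ^ suc k ∣_)
        (sym (trans (∑-inv²-extend k l {v} (λ i → even (suc i)) q≡) (∑-odd {inv² l} (suc v))))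
        (HalfSums.∑-odd-inv² k l v k≤l q≡))

    ∑-inv²-block : ∀ k l j → k ≤ l → P ^ k ∣ ∑ (p ℕ.^ k) (λ i → inv² l (j ℕ.* p ℕ.^ k ℕ.+ i))
    ∑-inv²-block zero    l j k≤l = 1∣ _
    ∑-inv²-block (suc k) l j k≤l with p^-odd (suc k)
    ... | v , q≡ = ∣-resp-≅ (∑-cong (p ℕ.^ suc k) λ i _ → inv²-shift j i k≤l)
      (subst (P ^ suc k ∣_) (sym total)
        (∣m∣n⇒∣m+n (HalfSums.∑-even-inv² k l v k≤l q≡) (HalfSums.∑-odd-inv² k l v k≤l q≡)))
      where
      open ≡-Reasoning
      total : ∑ (p ℕ.^ suc k) (inv² l) ≡ ∑ (suc v) (λ i → inv² l (i ℕ.* 2)) + ∑ (suc v) (λ i → inv² l (suc (i ℕ.* 2)))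
      total = begin
        ∑ (p ℕ.^ suc k) (inv² l)                     ≡⟨ ∑-cong-≡ (p ℕ.^ suc k) (λ i → ℤ.*-identityˡ (inv² l i)) ⟨
        ∑ (p ℕ.^ suc k) (λ i → 1ℤ * inv² l i)        ≡⟨ ∑-inv²-extend k l {v} (λ _ → 1ℤ) q≡ ⟩
        ∑ (suc v ℕ.* 2) (λ i → 1ℤ * inv² l i)        ≡⟨ ∑-cong-≡ (suc v ℕ.* 2) (λ i → ℤ.*-identityˡ (inv² l i)) ⟩
        ∑ (suc v ℕ.* 2) (inv² l)                     ≡⟨ ∑-even-odd (suc v) ⟩
        _                                            ∎

    -- Jacobsthal's congruence, with the powers of p in the binomial coefficient

    -- With V(x) = ∏ (x + i) over 0 < i ≤ n, p ∤ i, pairing i with n − i gives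
    -- V(x)² = ∏ (i (n − i) + Δ), where Δ = x (x + n) and i (n − i) ≡ −i² (mod n); here x = p c.
    module Jacobsthal (s t b c : ℕ) (p^s∣b : p ℕ.^ s ℕ.∣ b)
                      (p^∣ : P ^ (t ℕ.+ s) ∣ + c * (+ c + + b)) where

      private
        e n : ℕ
        -- Of this exponent, 2 + t + s comes from Δ = p² c (c + b), and 1 + s from the sum of
        -- inverse squares up to n = b p, which consists of whole blocks of length p^(1 + s).
        e = 3 ℕ.+ t ℕ.+ (s ℕ.+ s)
        n = b ℕ.* p

        pc Δ U V : ℤ
        pc = P * + c
        Δ = pc * (pc + + n)
        U = factors 0ℤ n
        V = factors pc n

        F : ℕ → ℤ
        F = inv² (suc s)

        p∣n : p ℕ.∣ n
        p∣n = ℕ.n∣m*n b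

        P^1+s∣n : P ^ suc s ∣ + n
        P^1+s∣n = subst₂ _∣_ (pos-^ p (suc s)) (cong +_ (ℕ.*-comm p b)) (pos-∣ (ℕ.*-monoʳ-∣ p p^s∣b))

        P^∣Δ : P ^ (2 ℕ.+ (t ℕ.+ s)) ∣ Δ
        P^∣Δ = subst₂ _∣_ (sym (ℤ.^-distribˡ-+-* P 2 (t ℕ.+ s)))
          (trans (regroup P (+ c) (+ b)) (cong (λ m → P * + c * (P * + c + m)) (sym (ℤ.pos-* b p))))
          (*-∣ {M = P ^ 2} ∣-refl p^∣)
          where
          regroup : ∀ p c b → (p * (p * 1ℤ)) * (c * (c + b)) ≡ p * c * (p * c + b * p)
          regroup = solve-∀

        -- Twice 2 + t + s exceeds `e` by t + 1, so the product of the 1 - Δ i⁻² may be replaced by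
        -- its linear part.
        P^∣Δ*Δ : P ^ e ∣ - Δ * - Δ
        P^∣Δ*Δ = ∣-trans (^-monoʳ-∣ P e≤)
          (subst (_∣ - Δ * - Δ) (sym (ℤ.^-distribˡ-+-* P (2 ℕ.+ (t ℕ.+ s)) (2 ℕ.+ (t ℕ.+ s))))
            (*-∣ (∣m⇒∣-m P^∣Δ) (∣m⇒∣-m P^∣Δ)))
          where
          e≤ : e ≤ (2 ℕ.+ (t ℕ.+ s)) ℕ.+ (2 ℕ.+ (t ℕ.+ s))
          e≤ = subst (e ≤_) (total s t) (ℕ.m≤m+n e (suc t))
            where
            total : ∀ s t → (3 ℕ.+ t ℕ.+ (s ℕ.+ s)) ℕ.+ suc t ≡ (2 ℕ.+ (t ℕ.+ s)) ℕ.+ (2 ℕ.+ (t ℕ.+ s))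
            total = ℕ-Solver.solve-∀

        P^e≡ : P ^ (2 ℕ.+ (t ℕ.+ s)) * P ^ suc s ≡ P ^ e
        P^e≡ = trans (sym (ℤ.^-distribˡ-+-* P (2 ℕ.+ (t ℕ.+ s)) (suc s))) (cong (P ^_) (total s t))
          where
          total : ∀ s t → 2 ℕ.+ (t ℕ.+ s) ℕ.+ suc s ≡ 3 ℕ.+ t ℕ.+ (s ℕ.+ s)
          total = ℕ-Solver.solve-∀

        P^∣Δ*∑ : P ^ e ∣ - Δ * ∑ (suc n) F
        P^∣Δ*∑ = subst (_∣ - Δ * ∑ (suc n) F) P^e≡ (*-∣ (∣m⇒∣-m P^∣Δ) (∣m∣n⇒∣m+n (P^∣∑ p^s∣b) P^∣last))
          where
          P^∣last : P ^ suc s ∣ F n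
          P^∣last = subst (P ^ suc s ∣_) (sym (inv²-∣ (suc s) p∣n)) (divides 0ℤ refl)
          P^∣∑ : p ℕ.^ s ℕ.∣ b → P ^ suc s ∣ ∑ n F
          P^∣∑ (ℕ.divides q b≡) = subst (P ^ suc s ∣_) (sym (trans (cong (λ m → ∑ m F) n≡) (∑-blocks q (p ℕ.^ suc s))))
            (∑-∣ q λ j → ∑-inv²-block (suc s) (suc s) j ℕ.≤-refl)
            where
            n≡ : n ≡ q ℕ.* p ℕ.^ suc s
            n≡ = trans (cong (ℕ._* p) b≡) (trans (ℕ.*-assoc q (p ℕ.^ s) p) (cong (q ℕ.*_) (ℕ.*-comm (p ℕ.^ s) p)))

        pair : ∀ i → i < suc n →
               factor pc i * factor pc (n ∸ i) ≅
               (factor 0ℤ i * factor 0ℤ (n ∸ i)) * (1ℤ + - Δ * F i) [ P ^ e ]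
        pair i i≤n with p ℕ.∣? i
        ... | yes p∣i = ≡⇒≅ (begin
          factor pc i * factor pc (n ∸ i)                             ≡⟨ cong₂ _*_ (factor-∣ p∣i) (factor-∣ p∣n∸i) ⟩
          1ℤ                                                        ≡⟨ cong (λ y → 1ℤ + y) (ℤ.*-zeroʳ (- Δ)) ⟨
          1ℤ + - Δ * 0ℤ                                             ≡⟨ cong (λ f → 1ℤ + - Δ * f) (inv²-∣ (suc s) p∣i) ⟨
          1ℤ + - Δ * F i                                            ≡⟨ ℤ.*-identityˡ _ ⟨
          1ℤ * (1ℤ + - Δ * F i)                                     ≡⟨ cong (_* (1ℤ + - Δ * F i)) (cong₂ _*_ (factor-∣ p∣i) (factor-∣ p∣n∸i)) ⟨
          (factor 0ℤ i * factor 0ℤ (n ∸ i)) * (1ℤ + - Δ * F i)      ∎)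
          where
          open ≡-Reasoning
          p∣n∸i : p ℕ.∣ n ∸ i
          p∣n∸i = ℕ.∣m+n∣m⇒∣n (subst (p ℕ.∣_) (sym (ℕ.m+[n∸m]≡n (ℕ.≤-pred i≤n))) p∣n) p∣i
        ... | no p∤i = begin
          factor pc i * factor pc (n ∸ i)
            ≡⟨ cong₂ _*_ (factor-∤ p∤i) (trans (factor-∤ p∤n∸i) (cong (λ m → pc + m) (pos-∸ (ℕ.≤-pred i≤n)))) ⟩
          (pc + + i) * (pc + (+ n - + i))
            ≡⟨ expand pc (+ n) (+ i) ⟩
          + i * (+ n - + i) + Δ * 1ℤ
            ≈⟨ +-cong (≅-refl {+ i * (+ n - + i)}) Δ*≅ ⟩
          + i * (+ n - + i) + Δ * ((+ i * + i - + n * + i) * F i)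
            ≡⟨ regroup (+ n) (+ i) Δ (F i) ⟩
          ((0ℤ + + i) * (0ℤ + (+ n - + i))) * (1ℤ + - Δ * F i)
            ≡⟨ cong (_* (1ℤ + - Δ * F i)) (cong₂ _*_ (factor-∤ p∤i) (trans (factor-∤ p∤n∸i) (cong (λ m → 0ℤ + m) (pos-∸ (ℕ.≤-pred i≤n))))) ⟨
          (factor 0ℤ i * factor 0ℤ (n ∸ i)) * (1ℤ + - Δ * F i) ∎
          where
          open ≅-Reasoning (P ^ e)
          p∤n∸i : ¬ p ℕ.∣ n ∸ i
          p∤n∸i p∣n∸i = p∤i (ℕ.∣m+n∣m⇒∣n (subst (p ℕ.∣_) (sym (ℕ.m∸n+n≡m (ℕ.≤-pred i≤n))) p∣n) p∣n∸i)
          expand : ∀ x n i → (x + i) * (x + (n - i)) ≡ i * (n - i) + (x * (x + n)) * 1ℤ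
          expand = solve-∀
          regroup : ∀ n i m f → i * (n - i) + m * ((i * i - n * i) * f) ≡
                                ((0ℤ + i) * (0ℤ + (n - i))) * (1ℤ + - m * f)
          regroup = solve-∀
          i*i-n*i≅ : (+ i * + i - + n * + i) * F i ≅ 1ℤ [ P ^ suc s ]
          i*i-n*i≅ = ≅-trans
            (∣-diff (divides-by (+ n) (- (+ i * F i)) (cancel (+ i) (+ n) (F i)) P^1+s∣n))
            (inv²-∤ (suc s) p∤i)
            where
            divides-by : ∀ z y {w} → w ≡ y * z → P ^ suc s ∣ z → P ^ suc s ∣ w
            divides-by z y refl = ∣n⇒∣m*n y
            cancel : ∀ i n f → (i * i - n * i) * f - (i * i) * f ≡ - (i * f) * n
            cancel = solve-∀
          Δ*≅ : Δ * 1ℤ ≅ Δ * ((+ i * + i - + n * + i) * F i) [ P ^ e ]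
          Δ*≅ = subst (λ m → Δ * 1ℤ ≅ Δ * ((+ i * + i - + n * + i) * F i) [ m ]) P^e≡
            (*-scale P^∣Δ (≅-sym i*i-n*i≅))

        square : ∀ y → factors y n * factors y n ≡ ∏ (suc n) (λ i → factor y i * factor y (n ∸ i))
        square y = trans (cong (factors y n *_) (∏-reverse (suc n))) (sym (∏-* (suc n)))

        V²≅U² : V * V ≅ U * U [ P ^ e ]
        V²≅U² = begin
          V * V                                                     ≡⟨ square pc ⟩
          ∏ (suc n) (λ i → factor pc i * factor pc (n ∸ i))           ≈⟨ ∏-cong (suc n) pair ⟩
          ∏ (suc n) (λ i → (factor 0ℤ i * factor 0ℤ (n ∸ i)) * (1ℤ + - Δ * F i))   ≡⟨ ∏-* (suc n) ⟩
          ∏ (suc n) (λ i → factor 0ℤ i * factor 0ℤ (n ∸ i)) * ∏ (suc n) (λ i → 1ℤ + - Δ * F i)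
            ≡⟨ cong (_* ∏ (suc n) (λ i → 1ℤ + - Δ * F i)) (square 0ℤ) ⟨
          U * U * ∏ (suc n) (λ i → 1ℤ + - Δ * F i)                  ≈⟨ *-congˡ (U * U) (∏-1+≅ {x = - Δ} {f = F} (suc n) P^∣Δ*Δ) ⟩
          U * U * (1ℤ + - Δ * ∑ (suc n) F)                          ≈⟨ *-congˡ (U * U) (+-cong (≅-refl {1ℤ}) (∣⇒≅0 P^∣Δ*∑)) ⟩
          U * U * 1ℤ                                                ≡⟨ ℤ.*-identityʳ (U * U) ⟩
          U * U                                                     ∎
          where open ≅-Reasoning (P ^ e)

        -- V ≡ U already holds modulo p, so V + U ≡ 2U is a unit and can be cancelled from V² - U² =
        -- (V + U)(V - U).
        V≅U : V ≅ U [ P ^ e ]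
        V≅U = ∣-diff (Unit-cancel-∣ V+U-unit e (subst (P ^ e ∣_) (factorise V U) (diff V²≅U²)))
          where
          factorise : ∀ v u → v * v - u * u ≡ (v + u) * (v - u)
          factorise = solve-∀
          double : ∀ u → u + u ≡ + 2 * u
          double = solve-∀
          V+U-unit : Unit (V + U)
          V+U-unit = Unit-resp-≅
            (≅-trans (+-cong (factors-cong n (∣⇒≅0 (∣m⇒∣m*n (+ c) ∣-refl))) (≅-refl {U})) (≡⇒≅ (double U)))
            (Unit-* (Unit-pos (p∤ 2 (s≤s (s≤s (s≤s z≤n))))) (factors₀-unit n))

      -- The ratio of the two coefficients is V / U. The congruence V ≡ U gets multiplied by (c + b
      -- choose b), whose factor pᵈ adds to the exponent.
      jacobsthal : ∀ d → P ^ d ∣ + ((c ℕ.+ b) C b) →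
                   + ((c ℕ.* p ℕ.+ b ℕ.* p) C (b ℕ.* p)) ≅ + ((c ℕ.+ b) C b) [ P ^ (d ℕ.+ e) ]
      jacobsthal d P^d∣ = Unit-cancel (factors₀-unit n) (d ℕ.+ e) (begin
        U * Y           ≡⟨ ℤ.*-comm U Y ⟩
        Y * U           ≡⟨ rising ⟩
        V * X           ≡⟨ ℤ.*-comm V X ⟩
        X * V           ≈⟨ subst (λ m → X * V ≅ X * U [ m ]) (sym (ℤ.^-distribˡ-+-* P d e)) (*-scale P^d∣ V≅U) ⟩
        X * U           ≡⟨ ℤ.*-comm X U ⟩
        U * X           ∎)
        where
        open ≅-Reasoning (P ^ (d ℕ.+ e))
        X Y : ℤ
        X = + ((c ℕ.+ b) C b)
        Y = + ((c ℕ.* p ℕ.+ b ℕ.* p) C (b ℕ.* p))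
        rising : Y * U ≡ V * X
        rising = subst (λ k → + ((c ℕ.* p ℕ.+ k) C k) * factors 0ℤ k ≡ factors pc k * X) (ℕ.+-identityʳ n)
          (rising-factors (C-isRising-* c) (C-isRising c) b 0 (ℕ.<-≤-trans (s≤s z≤n) 5≤p))

    -- The p-adic valuation of `j` capped at `t`: either the cap is reached, d = 0, or the cofactor
    -- `j′` is prime to p. The cap also covers j = 0.
    valuation : ∀ t j → ∃[ d ] ∃[ s ] ∃[ j′ ] d ℕ.+ s ≡ t × j ≡ j′ ℕ.* p ℕ.^ s × (d ≡ 0 ⊎ ¬ p ℕ.∣ j′)
    valuation zero    j = 0 , 0 , j , refl , sym (ℕ.*-identityʳ j) , inj₁ refl
    valuation (suc t) j with valuation t j
    ... | d , s , j′ , refl , j≡ , inj₂ p∤j′ = suc d , s , j′ , refl , j≡ , inj₂ p∤j′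
    ... | d , s , j′ , refl , j≡ , inj₁ refl with p ℕ.∣? j′
    ... | no p∤j′ = 1 , s , j′ , refl , j≡ , inj₂ p∤j′
    ... | yes (ℕ.divides q refl) = 0 , suc s , q , refl , trans j≡ (ℕ.*-assoc q p (p ℕ.^ s)) , inj₁ refl

    P^nonZero : ∀ k → NonZero (P ^ k)
    P^nonZero k = subst NonZero (pos-^ p k) (ℕ.m^n≢0 p k)

    -- By n ∣ k (n choose k), where k = j′ pˢ: of the d + s factors p in n, k absorbs only s when p
    -- ∤ j′.
    ∣C : ∀ d s n j′ → P ^ (d ℕ.+ s) ∣ + n → d ≡ 0 ⊎ ¬ p ℕ.∣ j′ → P ^ d ∣ + (n C (j′ ℕ.* p ℕ.^ s))
    ∣C d s n j′ p∣n (inj₁ refl) = 1∣ _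
    ∣C d s n j′ p∣n (inj₂ p∤j′) = Unit-cancel-∣ (Unit-pos p∤j′) d
      (*-cancelʳ-∣ (P ^ s) {{P^nonZero s}} (subst₂ _∣_ (ℤ.^-distribˡ-+-* P d s)
        (trans (cong (_* X) (trans (ℤ.pos-* j′ (p ℕ.^ s)) (cong (+ j′ *_) (pos-^ p s)))) (regroup (+ j′) (P ^ s) X))
        (∣-trans p∣n (n∣k*nCk n (j′ ℕ.* p ℕ.^ s)))))
      where
      X : ℤ
      X = + (n C (j′ ℕ.* p ℕ.^ s))
      regroup : ∀ j q x → j * q * x ≡ j * x * q
      regroup = solve-∀

    C-multiple : ∀ s t d n j → p ℕ.^ s ℕ.∣ j → P ^ (t ℕ.+ s) ∣ (+ n - + j) * + n → P ^ d ∣ + (n C j) →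
                 + ((n ℕ.* p) C (j ℕ.* p)) ≅ + (n C j) [ P ^ (d ℕ.+ (3 ℕ.+ t ℕ.+ (s ℕ.+ s))) ]
    C-multiple s t d n j p^s∣j p^∣ p^d∣ with j ℕ.≤? n
    ... | no j≰n = ≡⇒≅ (cong +_ (trans (k>n⇒nCk≡0 (ℕ.*-monoˡ-< p (ℕ.≰⇒> j≰n))) (sym (k>n⇒nCk≡0 (ℕ.≰⇒> j≰n)))))
    ... | yes j≤n = from-difference (n ∸ j) (ℕ.m∸n+n≡m j≤n)
      where
      from-difference : ∀ c → c ℕ.+ j ≡ n →
                        + ((n ℕ.* p) C (j ℕ.* p)) ≅ + (n C j) [ P ^ (d ℕ.+ (3 ℕ.+ t ℕ.+ (s ℕ.+ s))) ]
      from-difference c refl = subst (λ m → + (m C (j ℕ.* p)) ≅ + ((c ℕ.+ j) C j) [ P ^ (d ℕ.+ (3 ℕ.+ t ℕ.+ (s ℕ.+ s))) ])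
        (sym (ℕ.*-distribʳ-+ p c j))
        (Jacobsthal.jacobsthal s t j c p^s∣j (subst (P ^ (t ℕ.+ s) ∣_) (cancel (+ c) (+ j)) p^∣) d p^d∣)
        where
        cancel : ∀ c j → (c + j - j) * (c + j) ≡ c * (c + j)
        cancel = solve-∀

    ∑-telescope : ∀ l (w : ℕ → ℤ) (G : ℕ → ℕ → ℤ) →
          (∀ s j → s ≤ l → P ^ s ∣ ∑ (p ℕ.^ s) (λ i → w (j ℕ.* p ℕ.^ s ℕ.+ i))) →
          (∀ t j i → i < p → G (suc t) (j ℕ.* p ℕ.+ i) ≅ G t j [ P ^ suc t ]) →
          ∀ m t → t ≤ l → P ^ t ∣ ∑ (m ℕ.* p ℕ.^ t) (λ j → w j * G t j)
    ∑-telescope l w G w-block G-cong m t t≤l = subst (P ^ t ∣_)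
      (∑-cong-≡ (m ℕ.* p ℕ.^ t) λ j → cong (_* G t j) (W-zero j)) (descent 0 t t≤l)
      where
      W : ℕ → ℕ → ℤ
      W s j = ∑ (p ℕ.^ s) (λ i → w (j ℕ.* p ℕ.^ s ℕ.+ i))

      W-zero : ∀ j → W 0 j ≡ w j
      W-zero j = trans (ℤ.+-identityˡ _) (cong w (trans (ℕ.+-identityʳ (j ℕ.* 1)) (ℕ.*-identityʳ j)))

      W-suc : ∀ s j → ∑ p (λ i → W s (j ℕ.* p ℕ.+ i)) ≡ W (suc s) j
      W-suc s j = sym (trans (∑-blocks p (p ℕ.^ s)) (∑-cong-≡ p λ i → ∑-cong-≡ (p ℕ.^ s) λ i′ →
        cong w (regroup j p (p ℕ.^ s) i i′)))
        where
        regroup : ∀ j p q i i′ → j ℕ.* (p ℕ.* q) ℕ.+ (i ℕ.* q ℕ.+ i′) ≡ (j ℕ.* p ℕ.+ i) ℕ.* q ℕ.+ i′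
        regroup = ℕ-Solver.solve-∀

      descent : ∀ s t → s ℕ.+ t ≤ l → P ^ (s ℕ.+ t) ∣ ∑ (m ℕ.* p ℕ.^ t) (λ j → W s j * G t j)
      descent s zero s≤l = subst (λ k → P ^ k ∣ ∑ (m ℕ.* 1) (λ j → W s j * G 0 j)) (sym (ℕ.+-identityʳ s))
        (∑-∣ (m ℕ.* 1) λ j → ∣m⇒∣m*n (G 0 j) (w-block s j (subst (_≤ l) (ℕ.+-identityʳ s) s≤l)))
      descent s (suc t) s+t≤l = ∣-resp-≅ (begin
        ∑ (m ℕ.* (p ℕ.* p ℕ.^ t)) (λ j → W s j * G (suc t) j)
          ≡⟨ cong (λ n → ∑ n (λ j → W s j * G (suc t) j)) (regroup m p (p ℕ.^ t)) ⟩
        ∑ (m ℕ.* p ℕ.^ t ℕ.* p) (λ j → W s j * G (suc t) j)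
          ≡⟨ ∑-blocks (m ℕ.* p ℕ.^ t) p ⟩
        ∑ (m ℕ.* p ℕ.^ t) (λ j → ∑ p (λ i → W s (j ℕ.* p ℕ.+ i) * G (suc t) (j ℕ.* p ℕ.+ i)))
          ≈⟨ ∑-cong (m ℕ.* p ℕ.^ t) (λ j _ → ∑-cong p λ i i<p →
               subst (λ q → W s (j ℕ.* p ℕ.+ i) * G (suc t) (j ℕ.* p ℕ.+ i) ≅ W s (j ℕ.* p ℕ.+ i) * G t j [ q ])
                 (sym (ℤ.^-distribˡ-+-* P s (suc t)))
                 (*-scale (w-block s (j ℕ.* p ℕ.+ i) (ℕ.≤-trans (ℕ.m≤m+n s (suc t)) s+t≤l)) (G-cong t j i i<p))) ⟩
        ∑ (m ℕ.* p ℕ.^ t) (λ j → ∑ p (λ i → W s (j ℕ.* p ℕ.+ i) * G t j))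
          ≡⟨ ∑-cong-≡ (m ℕ.* p ℕ.^ t) (λ j → trans (sym (*-distribʳ-∑ (G t j) p)) (cong (_* G t j) (W-suc s j))) ⟩
        ∑ (m ℕ.* p ℕ.^ t) (λ j → W (suc s) j * G t j) ∎)
        (subst (λ k → P ^ k ∣ ∑ (m ℕ.* p ℕ.^ t) (λ j → W (suc s) j * G t j)) (sym (ℕ.+-suc s t))
          (descent (suc s) t (subst (_≤ l) (ℕ.+-suc s t) s+t≤l)))
        where
        open ≅-Reasoning (P ^ (s ℕ.+ suc t))
        regroup : ∀ m p q → m ℕ.* (p ℕ.* q) ≡ m ℕ.* q ℕ.* p
        regroup = ℕ-Solver.solve-∀

    -- The summands, and the terms with p ∣ k

    -- a is the exponent A − 2.
    module Summands (a b c : ℕ) where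

      rest summand : ℕ → ℕ → ℤ
      rest n k = (+ ((n ℕ.+ k) C k)) ^ b * (+ ((k ℕ.* 2) C n)) ^ c
      summand n k = (+ (n C k)) ^ 2 * ((+ (n C k)) ^ a * rest n k)

      summand-multiple : ∀ n t j → P ^ t ∣ + n →
                         summand (n ℕ.* p) (j ℕ.* p) ≅ summand n j [ P ^ (3 ℕ.* suc t) ]
      summand-multiple n t j p^t∣n with valuation t j
      ... | d , s , j′ , refl , j≡ , d≡0⊎p∤j′ = subst (λ m → X₁ ^ 2 * R₁ ≅ X ^ 2 * R [ m ]) modulus (≅-trans X₁²≅X² R₁≅R)
        where
        e : ℕ
        e = 3 ℕ.+ (d ℕ.+ s) ℕ.+ (s ℕ.+ s)
        p^s∣j : p ℕ.^ s ℕ.∣ j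
        p^s∣j = ℕ.divides j′ j≡
        P^s∣j : P ^ s ∣ + j
        P^s∣j = subst (_∣ + j) (pos-^ p s) (pos-∣ p^s∣j)
        P^s∣n : P ^ s ∣ + n
        P^s∣n = ∣-trans (^-monoʳ-∣ P (ℕ.m≤n+m s d)) p^t∣n
        X X₁ R R₁ : ℤ
        X  = + (n C j)
        X₁ = + ((n ℕ.* p) C (j ℕ.* p))
        R  = X ^ a * rest n j
        R₁ = X₁ ^ a * rest (n ℕ.* p) (j ℕ.* p)

        P^d∣X : P ^ d ∣ X
        P^d∣X = subst (λ m → P ^ d ∣ + (n C m)) (sym j≡) (∣C d s n j′ p^t∣n d≡0⊎p∤j′)

        split : ∀ x y → P ^ (d ℕ.+ s) ∣ x → P ^ s ∣ y → P ^ (d ℕ.+ s ℕ.+ s) ∣ y * x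
        split x y p q = subst₂ _∣_ (sym (ℤ.^-distribˡ-+-* P (d ℕ.+ s) s)) (ℤ.*-comm x y) (*-∣ p q)

        X₁≅X : X₁ ≅ X [ P ^ (d ℕ.+ e) ]
        X₁≅X = C-multiple s (d ℕ.+ s) d n j p^s∣j
          (split (+ n) (+ n - + j) p^t∣n (∣m∣n⇒∣m+n P^s∣n (∣m⇒∣-m P^s∣j))) P^d∣X

        swap : ∀ n j → (n + j) * n ≡ (n + j - j) * (n + j)
        swap = solve-∀

        2jp≡ : ∀ j p → j ℕ.* 2 ℕ.* p ≡ j ℕ.* p ℕ.* 2
        2jp≡ = ℕ-Solver.solve-∀

        Y₁≅Y : + ((n ℕ.* p ℕ.+ j ℕ.* p) C (j ℕ.* p)) ≅ + ((n ℕ.+ j) C j) [ P ^ e ]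
        Y₁≅Y = subst (λ m → + (m C (j ℕ.* p)) ≅ + ((n ℕ.+ j) C j) [ P ^ e ]) (ℕ.*-distribʳ-+ p n j)
          (C-multiple s (d ℕ.+ s) 0 (n ℕ.+ j) j p^s∣j
            (subst (P ^ (d ℕ.+ s ℕ.+ s) ∣_) (swap (+ n) (+ j))
              (split (+ n) (+ n + + j) p^t∣n (∣m∣n⇒∣m+n P^s∣n P^s∣j))) (1∣ _))

        -- With l = 2j - n this is the congruence for (n + l choose l); pˢ divides l because it
        -- divides both n and 2j.
        Z₁≅Z : + ((j ℕ.* p ℕ.* 2) C (n ℕ.* p)) ≅ + ((j ℕ.* 2) C n) [ P ^ e ]
        Z₁≅Z with n ℕ.≤? j ℕ.* 2
        ... | no n≰2j = ≡⇒≅ (cong +_ (trans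
          (k>n⇒nCk≡0 (subst (ℕ._< n ℕ.* p) (2jp≡ j p) (ℕ.*-monoˡ-< p (ℕ.≰⇒> n≰2j))))
          (sym (k>n⇒nCk≡0 (ℕ.≰⇒> n≰2j)))))
        ... | yes n≤2j = from-difference (j ℕ.* 2 ∸ n) (ℕ.m+[n∸m]≡n n≤2j)
          where
          from-difference : ∀ l → n ℕ.+ l ≡ j ℕ.* 2 →
                            + ((j ℕ.* p ℕ.* 2) C (n ℕ.* p)) ≅ + ((j ℕ.* 2) C n) [ P ^ e ]
          from-difference l n+l≡2j = subst₂ (λ x y → + x ≅ + y [ P ^ e ])
            (trans (cong (_C (l ℕ.* p)) (ℕ.*-distribʳ-+ p n l)) (trans (sym (nCn+k≡ (n ℕ.* p) (l ℕ.* p)))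
              (cong (_C (n ℕ.* p)) (trans (sym (ℕ.*-distribʳ-+ p n l)) (trans (cong (ℕ._* p) n+l≡2j) (2jp≡ j p))))))
            (trans (sym (nCn+k≡ n l)) (cong (_C n) n+l≡2j))
            (C-multiple s (d ℕ.+ s) 0 (n ℕ.+ l) l (ℕ.∣m+n∣m⇒∣n p^s∣n+l p^s∣n)
              (subst (P ^ (d ℕ.+ s ℕ.+ s) ∣_) (swap (+ n) (+ l))
                (split (+ n) (+ n + + l) p^t∣n (subst (_∣ + (n ℕ.+ l)) (pos-^ p s) (pos-∣ p^s∣n+l)))) (1∣ _))
            where
            p^s∣n : p ℕ.^ s ℕ.∣ n
            p^s∣n = ∣⇒∣ᵤ (subst (_∣ + n) (sym (pos-^ p s)) P^s∣n)
            p^s∣n+l : p ℕ.^ s ℕ.∣ n ℕ.+ l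
            p^s∣n+l = subst (p ℕ.^ s ℕ.∣_) (sym n+l≡2j) (ℕ.∣m⇒∣m*n 2 p^s∣j)

        R₁≅R : X ^ 2 * R₁ ≅ X ^ 2 * R [ P ^ (d ℕ.+ (d ℕ.+ e)) ]
        R₁≅R = subst (λ m → X ^ 2 * R₁ ≅ X ^ 2 * R [ m ]) modulus′
          (*-scale (*-∣ P^d∣X (subst (P ^ d ∣_) (sym (ℤ.*-identityʳ X)) P^d∣X))
            (*-cong (^-cong a (≅-weaken (^-monoʳ-∣ P (ℕ.m≤n+m e d)) X₁≅X)) (*-cong (^-cong b Y₁≅Y) (^-cong c Z₁≅Z))))
          where
          modulus′ : P ^ d * P ^ d * P ^ e ≡ P ^ (d ℕ.+ (d ℕ.+ e))
          modulus′ = sym (trans (ℤ.^-distribˡ-+-* P d (d ℕ.+ e))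
            (trans (cong (P ^ d *_) (ℤ.^-distribˡ-+-* P d e)) (sym (ℤ.*-assoc (P ^ d) (P ^ d) (P ^ e)))))

        -- The two copies of `X₁` are exchanged one at a time: each exchange is exact modulo p^(d +
        -- e), and the other copy adds its own pᵈ.
        X₁²≅X² : X₁ ^ 2 * R₁ ≅ X ^ 2 * R₁ [ P ^ (d ℕ.+ (d ℕ.+ e)) ]
        X₁²≅X² = *-congʳ R₁ (begin
          X₁ * (X₁ * 1ℤ)    ≡⟨ cong (X₁ *_) (ℤ.*-identityʳ X₁) ⟩
          X₁ * X₁           ≈⟨ scale P^d∣X₁ ⟩
          X₁ * X            ≡⟨ ℤ.*-comm X₁ X ⟩
          X * X₁            ≈⟨ scale P^d∣X ⟩
          X * X             ≡⟨ cong (X *_) (ℤ.*-identityʳ X) ⟨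
          X * (X * 1ℤ)      ∎)
          where
          open ≅-Reasoning (P ^ (d ℕ.+ (d ℕ.+ e)))
          P^d∣X₁ : P ^ d ∣ X₁
          P^d∣X₁ = ∣-resp-≅ (≅-weaken (^-monoʳ-∣ P (ℕ.m≤m+n d e)) X₁≅X) P^d∣X
          scale : ∀ {y} → P ^ d ∣ y → y * X₁ ≅ y * X [ P ^ (d ℕ.+ (d ℕ.+ e)) ]
          scale {y} p^d∣y = subst (λ m → y * X₁ ≅ y * X [ m ]) (sym (ℤ.^-distribˡ-+-* P d (d ℕ.+ e))) (*-scale p^d∣y X₁≅X)

        modulus : P ^ (d ℕ.+ (d ℕ.+ e)) ≡ P ^ (3 ℕ.* suc (d ℕ.+ s))
        modulus = cong (P ^_) (total d s)
          where
          total : ∀ d s → d ℕ.+ (d ℕ.+ (3 ℕ.+ (d ℕ.+ s) ℕ.+ (s ℕ.+ s))) ≡ 3 ℕ.* suc (d ℕ.+ s)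
          total = ℕ-Solver.solve-∀

      -- The terms with p ∤ k

      -- C(N, k)² = N² C(N − 1, k)² / (N − k)², and (N − k)² ≡ k² (mod pʳ) if pʳ ∣ N, so for p ∤ k
      -- the summand is N² k⁻² times cofactor N k (2 k); the cofactor depends on k only through ⌊2 k / p⌋
      -- when it is taken modulo pʳ.
      cofactor : ℕ → ℕ → ℕ → ℤ
      cofactor n k h = (+ (ℕ.pred n C k)) ^ 2 * ((+ ((n ℕ.+ k) C k)) ^ b * (+ (h C n)) ^ c)

      -- In the manner of Lucas, the last base-p digits of h and of ⌊h / 2⌋ are dropped while n p
      -- becomes n; the congruence reaches pʳ because pʳ ∣ n p.
      cofactor-cong : ∀ n r j i → .{{ℕ.NonZero n}} → i < p → P ^ r ∣ + (n ℕ.* p) →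
        cofactor (n ℕ.* p) ⌊ j ℕ.* p ℕ.+ i /2⌋ (j ℕ.* p ℕ.+ i) ≅ cofactor n ⌊ j /2⌋ j [ P ^ r ]
      cofactor-cong n@(suc n′) r j i i<p p^r∣ with ⌊/2⌋-block p j i i<p
      ... | i′ , i′<p , half≡ = subst
        (λ k → cofactor (n ℕ.* p) k (j ℕ.* p ℕ.+ i) ≅ cofactor n ⌊ j /2⌋ j [ P ^ r ]) (sym half≡)
        (*-cong (C²-cong r ⌊ j /2⌋ i′ 1+pred≡ i′<p (subst (λ m → P ^ r ∣ + m) (sym 1+pred≡) p^r∣))
          (*-cong (^-cong b (C-cong n r ⌊ j /2⌋ i′ i′<p p^r∣)) (^-cong c Z≅)))
        where
        1+pred≡ : suc (ℕ.pred (n ℕ.* p)) ≡ n ℕ.* p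
        1+pred≡ = ℕ.suc-pred (n ℕ.* p) {{ℕ.m*n≢0 n p}}

        Z≅ : + ((j ℕ.* p ℕ.+ i) C (n ℕ.* p)) ≅ + (j C n) [ P ^ r ]
        Z≅ with n ℕ.≤? j
        ... | no n≰j = ≡⇒≅ (cong +_ (trans
          (k>n⇒nCk≡0 (ℕ.<-≤-trans (subst (j ℕ.* p ℕ.+ i <_) (ℕ.+-comm (j ℕ.* p) p) (ℕ.+-monoʳ-< (j ℕ.* p) i<p)) (ℕ.*-monoˡ-≤ p (ℕ.≰⇒> n≰j))))
          (sym (k>n⇒nCk≡0 (ℕ.≰⇒> n≰j)))))
        ... | yes n≤j = from-difference (j ∸ n) (ℕ.m+[n∸m]≡n n≤j)
          where
          from-difference : ∀ l → n ℕ.+ l ≡ j → + ((j ℕ.* p ℕ.+ i) C (n ℕ.* p)) ≅ + (j C n) [ P ^ r ]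
          from-difference l refl = subst₂ (λ x y → + x ≅ + y [ P ^ r ])
            (trans (sym (nCn+k≡ (n ℕ.* p) (l ℕ.* p ℕ.+ i))) (cong (_C (n ℕ.* p)) (regroup n l p i)))
            (sym (nCn+k≡ n l))
            (C-cong n r l i i<p p^r∣)
            where
            regroup : ∀ n l p i → n ℕ.* p ℕ.+ (l ℕ.* p ℕ.+ i) ≡ (n ℕ.+ l) ℕ.* p ℕ.+ i
            regroup = ℕ-Solver.solve-∀

      -- The precision `l` of the inverse squares is kept apart from r: the summands are rewritten
      -- modulo p^(3r), while the sum is evaluated modulo pʳ.
      weighted : ℕ → ℕ → ℕ → ℤ
      weighted l n k = inv² l k * cofactor n k (k ℕ.* 2)

      -- The sum is moved to the even h = 2k below 2N, where `∑-telescope` applies with the weights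
      -- `evenInv² l h`; the factor 4 is (h / k)².
      ∑-weighted : ∀ l m r → .{{ℕ.NonZero m}} → r ≤ l → P ^ r ∣ ∑ (m ℕ.* p ℕ.^ r) (weighted l (m ℕ.* p ℕ.^ r))
      ∑-weighted l m r r≤l = ∣-resp-≅ (begin
        ∑ N (weighted l N)
          ≈⟨ ∑-cong N (λ k _ → *-congʳ (cofactor N k (k ℕ.* 2))
               (≅-weaken (^-monoʳ-∣ P r≤l) (≅-sym (4*inv²-double l k)))) ⟩
        ∑ N (λ k → + 4 * inv² l (k ℕ.* 2) * cofactor N k (k ℕ.* 2))
          ≡⟨ ∑-cong-≡ N (λ k → trans (ℤ.*-assoc (+ 4) (inv² l (k ℕ.* 2)) (cofactor N k (k ℕ.* 2)))
               (cong (λ u → + 4 * (inv² l (k ℕ.* 2) * cofactor N u (k ℕ.* 2))) (sym (⌊*2/2⌋ k)))) ⟩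
        ∑ N (λ k → + 4 * w (k ℕ.* 2))          ≡⟨ *-distribˡ-∑ (+ 4) N ⟨
        + 4 * ∑ N (λ k → w (k ℕ.* 2))          ≡⟨ cong (+ 4 *_) (∑-even {w} N) ⟨
        + 4 * ∑ (N ℕ.* 2) (λ h → even h * w h)
          ≡⟨ cong (+ 4 *_) (trans (cong (λ n → ∑ n (λ h → even h * w h)) (regroup m (p ℕ.^ r)))
               (∑-cong-≡ (m ℕ.* 2 ℕ.* p ℕ.^ r) λ h → sym (ℤ.*-assoc (even h) (inv² l h) (G r h)))) ⟩
        + 4 * ∑ (m ℕ.* 2 ℕ.* p ℕ.^ r) (λ h → evenInv² l h * G r h) ∎)
        (∣n⇒∣m*n (+ 4) (∑-telescope l (evenInv² l) G
          (λ s j s≤l → ∑-evenInv²-block s l j s≤l) G-cong (m ℕ.* 2) r r≤l))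
        where
        open ≅-Reasoning (P ^ r)
        N : ℕ
        N = m ℕ.* p ℕ.^ r
        G : ℕ → ℕ → ℤ
        G t h = cofactor (m ℕ.* p ℕ.^ t) ⌊ h /2⌋ h
        w : ℕ → ℤ
        w h = inv² l h * G r h
        regroup : ∀ m q → m ℕ.* q ℕ.* 2 ≡ m ℕ.* 2 ℕ.* q
        regroup = ℕ-Solver.solve-∀
        G-cong : ∀ t j i → i < p → G (suc t) (j ℕ.* p ℕ.+ i) ≅ G t j [ P ^ suc t ]
        G-cong t j i i<p = subst (λ n → cofactor n ⌊ j ℕ.* p ℕ.+ i /2⌋ (j ℕ.* p ℕ.+ i) ≅ G t j [ P ^ suc t ]) (sym n≡)
          (cofactor-cong (m ℕ.* p ℕ.^ t) (suc t) j i {{ℕ.m*n≢0 m (p ℕ.^ t) {{it}} {{ℕ.m^n≢0 p t}}}} i<p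
            (subst₂ _∣_ (pos-^ p (suc t)) (cong +_ n≡) (pos-∣ (ℕ.n∣m*n m))))
          where
          n≡ : m ℕ.* p ℕ.^ suc t ≡ m ℕ.* p ℕ.^ t ℕ.* p
          n≡ = trans (cong (m ℕ.*_) (ℕ.*-comm p (p ℕ.^ t))) (sym (ℕ.*-assoc m (p ℕ.^ t) p))

      P^3*≡ : ∀ r → P ^ r * P ^ r * P ^ r ≡ P ^ (3 ℕ.* r)
      P^3*≡ r = sym (begin
        P ^ (r ℕ.+ (r ℕ.+ (r ℕ.+ 0)))         ≡⟨ ℤ.^-distribˡ-+-* P r (r ℕ.+ (r ℕ.+ 0)) ⟩
        P ^ r * P ^ (r ℕ.+ (r ℕ.+ 0))         ≡⟨ cong (P ^ r *_) (ℤ.^-distribˡ-+-* P r (r ℕ.+ 0)) ⟩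
        P ^ r * (P ^ r * P ^ (r ℕ.+ 0))       ≡⟨ cong (λ s → P ^ r * (P ^ r * P ^ s)) (ℕ.+-identityʳ r) ⟩
        P ^ r * (P ^ r * P ^ r)               ≡⟨ ℤ.*-assoc (P ^ r) (P ^ r) (P ^ r) ⟨
        P ^ r * P ^ r * P ^ r                 ∎)
        where open ≡-Reasoning

      -- The factor 0ᵃ is 1 if a = 0 and otherwise 0: the remaining powers of C(N, k) vanish modulo pʳ.
      summand-∤ : ∀ n r k → .{{ℕ.NonZero n}} → P ^ r ∣ + n → ¬ p ℕ.∣ k →
        summand n k ≅ (+ n * + n) * (0ℤ ^ a * weighted (3 ℕ.* r) n k) [ P ^ (3 ℕ.* r) ]
      summand-∤ (suc n) r k p^r∣N p∤k = begin
        X ^ 2 * (X ^ a * R)                ≈⟨ *-congʳ (X ^ a * R) X²≅ ⟩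
        F * (N * N * Y ^ 2) * (X ^ a * R)  ≡⟨ regroup F N (Y ^ 2) (X ^ a) R ⟩
        N * N * (X ^ a * (F * (Y ^ 2 * R)))
          ≈⟨ subst (λ m → N * N * (X ^ a * W) ≅ N * N * (0ℤ ^ a * W) [ m ]) (P^3*≡ r)
               (*-scale (*-∣ p^r∣N p^r∣N) (*-congʳ W (^-cong a (∣⇒≅0 P^r∣X)))) ⟩
        N * N * (0ℤ ^ a * W)               ∎
        where
        open ≅-Reasoning (P ^ (3 ℕ.* r))
        N X Y F R W : ℤ
        N = + suc n
        X = + (suc n C k)
        Y = + (n C k)
        F = inv² (3 ℕ.* r) k
        R = rest (suc n) k
        W = F * (Y ^ 2 * R)

        regroup : ∀ f n y x r → f * (n * n * y) * (x * r) ≡ n * n * (x * (f * (y * r)))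
        regroup = solve-∀

        P^r∣X : P ^ r ∣ X
        P^r∣X = Unit-cancel-∣ (Unit-pos p∤k) r (∣-trans p^r∣N (n∣k*nCk (suc n) k))

        -- As (N - k) X = N Y, the difference of the two sides is X² N (2k - N); pʳ divides X twice
        -- and N once, which gives 3r.
        k²X²≅N²Y² : (+ k * + k) * (X * X) ≅ N * N * (Y * Y) [ P ^ (3 ℕ.* r) ]
        k²X²≅N²Y² = ∣-diff (subst₂ _∣_ (P^3*≡ r)
          (trans (expand N (+ k) X) (cong (λ t → (+ k * + k) * (X * X) - t)
            (trans (cong (λ t → t * t) ([n-k]*nCk n k)) (square N Y))))
          (*-∣ (*-∣ P^r∣X P^r∣X) (∣m⇒∣m*n (+ 2 * + k - N) p^r∣N)))
          where
          expand : ∀ n k x → x * x * (n * (+ 2 * k - n)) ≡ (k * k) * (x * x) - ((n - k) * x) * ((n - k) * x)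
          expand = solve-∀
          square : ∀ n y → (n * y) * (n * y) ≡ n * n * (y * y)
          square = solve-∀

        ^2≡ : ∀ x → x ^ 2 ≡ x * x
        ^2≡ x = cong (x *_) (ℤ.*-identityʳ x)

        X²≅ : X ^ 2 ≅ F * (N * N * Y ^ 2) [ P ^ (3 ℕ.* r) ]
        X²≅ = begin
          X ^ 2                              ≡⟨ trans (^2≡ X) (sym (ℤ.*-identityˡ (X * X))) ⟩
          1ℤ * (X * X)                       ≈⟨ *-congʳ (X * X) (inv²-∤ (3 ℕ.* r) p∤k) ⟨
          (+ k * + k) * F * (X * X)          ≡⟨ swap (+ k * + k) F (X * X) ⟩
          F * ((+ k * + k) * (X * X))        ≈⟨ *-congˡ F k²X²≅N²Y² ⟩
          F * (N * N * (Y * Y))              ≡⟨ cong (λ y → F * (N * N * y)) (^2≡ Y) ⟨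
          F * (N * N * Y ^ 2)                ∎
          where
          swap : ∀ k f x → k * f * x ≡ f * (k * x)
          swap = solve-∀

      -- Collecting the terms

      ∑-summand-* : ∀ m t → .{{ℕ.NonZero m}} → let n = m ℕ.* p ℕ.^ t in
        ∑ (suc (n ℕ.* p)) (summand (n ℕ.* p)) ≅ ∑ (suc n) (summand n) [ P ^ (3 ℕ.* suc t) ]
      ∑-summand-* m t = +-cong (begin
          ∑ N (summand N)
            ≡⟨ ∑-blocks n p ⟩
          ∑ n (λ j → ∑ p (λ i → summand N (j ℕ.* p ℕ.+ i)))
            ≈⟨ ∑-cong n (λ j _ → ∑-first-cong p
                 (subst (λ k → summand N k ≅ summand n j [ Q ]) (sym (ℕ.+-identityʳ (j ℕ.* p))) (summand-multiple n t j P^t∣n))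
                 (remainder-∣ (subst (p ℕ.∣_) (sym (ℕ.+-identityʳ (j ℕ.* p))) (ℕ.n∣m*n j)))
                 (λ i i<p → summand-∤ N (suc t) (j ℕ.* p ℕ.+ suc i) P^1+t∣N
                   (λ p∣ → ℕ.>⇒∤ i<p (ℕ.∣m+n∣m⇒∣n p∣ (ℕ.n∣m*n j))))) ⟩
          ∑ n (λ j → summand n j + ∑ p (λ i → remainder (j ℕ.* p ℕ.+ i)))
            ≡⟨ ∑-+ n ⟩
          ∑ n (summand n) + ∑ n (λ j → ∑ p (λ i → remainder (j ℕ.* p ℕ.+ i)))
            ≡⟨ cong (λ x → ∑ n (summand n) + x) (∑-blocks n p) ⟨
          ∑ n (summand n) + ∑ N remainder
            ≈⟨ +-cong (≅-refl {∑ n (summand n)}) (∣⇒≅0 Q∣∑remainder) ⟩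
          ∑ n (summand n) + 0ℤ
            ≡⟨ ℤ.+-identityʳ _ ⟩
          ∑ n (summand n) ∎)
        -- The top index k = n p lies outside the n blocks of length p and is matched with the last
        -- term of the smaller sum.
        (summand-multiple n t n P^t∣n)
        where
        n N : ℕ
        n = m ℕ.* p ℕ.^ t
        N = n ℕ.* p
        Q : ℤ
        Q = P ^ (3 ℕ.* suc t)
        open ≅-Reasoning Q
        N≡ : m ℕ.* p ℕ.^ suc t ≡ N
        N≡ = trans (cong (m ℕ.*_) (ℕ.*-comm p (p ℕ.^ t))) (sym (ℕ.*-assoc m (p ℕ.^ t) p))
        instance
          p^t≢0 : ℕ.NonZero (p ℕ.^ t)
          p^t≢0 = ℕ.m^n≢0 p t
          n≢0 : ℕ.NonZero n
          n≢0 = ℕ.m*n≢0 m (p ℕ.^ t)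
          N≢0 : ℕ.NonZero N
          N≢0 = ℕ.m*n≢0 n p
        P^t∣n : P ^ t ∣ + n
        P^t∣n = subst (_∣ + n) (pos-^ p t) (pos-∣ (ℕ.n∣m*n m))
        P^1+t∣N : P ^ suc t ∣ + N
        P^1+t∣N = subst₂ _∣_ (pos-^ p (suc t)) (cong +_ N≡) (pos-∣ (ℕ.n∣m*n m))

        remainder : ℕ → ℤ
        remainder k = (+ N * + N) * (0ℤ ^ a * weighted (3 ℕ.* suc t) N k)

        remainder-∣ : ∀ {k} → p ℕ.∣ k → remainder k ≡ 0ℤ
        remainder-∣ {k} p∣k = trans
          (cong (λ f → (+ N * + N) * (0ℤ ^ a * (f * cofactor N k (k ℕ.* 2)))) (inv²-∣ (3 ℕ.* suc t) p∣k))
          (vanish (+ N * + N) (0ℤ ^ a) (cofactor N k (k ℕ.* 2)))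
          where
          vanish : ∀ n z y → n * (z * (0ℤ * y)) ≡ 0ℤ
          vanish = solve-∀

        Q∣∑remainder : Q ∣ ∑ N remainder
        Q∣∑remainder = subst₂ _∣_ (P^3*≡ (suc t))
          (trans (cong ((+ N * + N) *_) (*-distribˡ-∑ (0ℤ ^ a) N)) (*-distribˡ-∑ (+ N * + N) N))
          (*-∣ (*-∣ P^1+t∣N P^1+t∣N) (∣n⇒∣m*n (0ℤ ^ a)
            (subst (λ k → P ^ suc t ∣ ∑ k (weighted (3 ℕ.* suc t) k)) N≡
              (∑-weighted (3 ℕ.* suc t) m (suc t) (ℕ.m≤n*m (suc t) 3)))))

      +𝒮≡∑ : ∀ n → + 𝒮 n (2 ℕ.+ a) b c ≡ ∑ (suc n) (summand n)
      +𝒮≡∑ n = trans (cong (λ ks → + sum ks) (map-upTo s (suc n))) (trans (+sum≡∑ s (suc n)) (∑-cong-≡ (suc n) +s≡))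
        where
        s : ℕ → ℕ
        s k = (n C k) ℕ.^ (2 ℕ.+ a) ℕ.* ((n ℕ.+ k) C k) ℕ.^ b ℕ.* ((2 ℕ.* k) C n) ℕ.^ c
        +s≡ : ∀ k → + s k ≡ summand n k
        +s≡ k = begin
          + s k                                    ≡⟨ ℤ.pos-* ((n C k) ℕ.^ (2 ℕ.+ a) ℕ.* ((n ℕ.+ k) C k) ℕ.^ b) (((2 ℕ.* k) C n) ℕ.^ c) ⟩
          + ((n C k) ℕ.^ (2 ℕ.+ a) ℕ.* ((n ℕ.+ k) C k) ℕ.^ b) * + (((2 ℕ.* k) C n) ℕ.^ c)
            ≡⟨ cong (_* + (((2 ℕ.* k) C n) ℕ.^ c)) (ℤ.pos-* ((n C k) ℕ.^ (2 ℕ.+ a)) (((n ℕ.+ k) C k) ℕ.^ b)) ⟩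
          + ((n C k) ℕ.^ (2 ℕ.+ a)) * + (((n ℕ.+ k) C k) ℕ.^ b) * + (((2 ℕ.* k) C n) ℕ.^ c)
            ≡⟨ cong₂ (λ x y → x * y * + (((2 ℕ.* k) C n) ℕ.^ c)) (pos-^ (n C k) (2 ℕ.+ a)) (pos-^ ((n ℕ.+ k) C k) b) ⟩
          X ^ (2 ℕ.+ a) * Y ^ b * + (((2 ℕ.* k) C n) ℕ.^ c)
            ≡⟨ cong (X ^ (2 ℕ.+ a) * Y ^ b *_) (trans (cong (λ l → + ((l C n) ℕ.^ c)) (ℕ.*-comm 2 k)) (pos-^ ((k ℕ.* 2) C n) c)) ⟩
          X ^ (2 ℕ.+ a) * Y ^ b * Z ^ c            ≡⟨ cong (λ x → x * Y ^ b * Z ^ c) (ℤ.^-distribˡ-+-* X 2 a) ⟩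
          X ^ 2 * X ^ a * Y ^ b * Z ^ c            ≡⟨ regroup (X ^ 2) (X ^ a) (Y ^ b) (Z ^ c) ⟩
          X ^ 2 * (X ^ a * (Y ^ b * Z ^ c))        ∎
          where
          open ≡-Reasoning
          X Y Z : ℤ
          X = + (n C k)
          Y = + ((n ℕ.+ k) C k)
          Z = + ((k ℕ.* 2) C n)
          regroup : ∀ w x y z → w * x * y * z ≡ w * (x * (y * z))
          regroup = solve-∀

theorem1p2 : (a b c : ℕ) → 2 ≤ a → (m r p : ℕ) → 1 ≤ m → 1 ≤ r → Prime p → 5 ≤ p →
    𝒮 (m ℕ.* p ℕ.^ r) a b c ≡ 𝒮 (m ℕ.* p ℕ.^ (r ∸ 1)) a b c [mod p ℕ.^ (3 ℕ.* r) ]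
theorem1p2 (suc (suc a)) b c (s≤s (s≤s z≤n)) m@(suc _) (suc t) p _ _ p-prime 5≤p = ∣⇒∣ᵤ (subst₂ _∣_
  (sym (pos-^ p (3 ℕ.* suc t)))
  (cong₂ _-_ (trans (sym (S.+𝒮≡∑ (m ℕ.* p ℕ.^ t ℕ.* p))) (cong (λ n → + 𝒮 n (2 ℕ.+ a) b c) N≡)) (sym (S.+𝒮≡∑ (m ℕ.* p ℕ.^ t))))
  (diff (S.∑-summand-* m t)))
  where
  module S = Summands p p-prime 5≤p a b c
  N≡ : m ℕ.* p ℕ.^ t ℕ.* p ≡ m ℕ.* p ℕ.^ suc t
  N≡ = trans (ℕ.*-assoc m (p ℕ.^ t) p) (cong (m ℕ.*_) (ℕ.*-comm (p ℕ.^ t) p))
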